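{- The first-order theory $VW^+$ interprets the first-order theory $WD_R$ (both defined in the context).
   Context: "Interprets" refers to (relative) formal interpretability in the usual sense. Both theories include the usual axioms for identity. $WD_R$: $B^*$ is the set of nonempty finite strings of 0's and 1's, $^\frown$ is concatenation, and $s\sqsubseteq t$ between strings means $s$ is a (nonempty, possibly improper) initial segment of $t$. The vocabulary has a constant $\underline{s}$ for each $s\in B^*$, a binary relation symbol $\preccurlyeq$ and a ternary relation symbol $C$. Axioms: (1) $C(\underline{s},\underline{t},\underline{s^\frown t})$ for $s,t\in B^*$; (2) $\neg(\underline{s}=\underline{t})$ for distinct $s,t\in B^*$; (3) $\forall x(x\preccurlyeq\underline{t}\leftrightarrow\bigvee_{s\sqsubseteq t}x=\underline{s})$ for $t\in B^*$; (4) $\forall x,y\,\exists z\,C(x,y,z)$; (5) $\forall x,y,u,v\,(C(x,y,u)\ \&\ C(x,y,v)\to u=v)$. $VW^+$: $\Sigma^*$ is the set of finite words over $\{1,2\}$, including the empty word $e$; $lh(s)$ is the length of $s$; $s^{ -1}$ its reversal; $2^m$ the string of $m$ consecutive 2's ($2^0=e$). Signature $\{\underline{e},S_1,S_2,f,\sqsubseteq,|{\le}|\}$ ($\underline{e}$ a constant, $S_1,S_2,f$ unary functions, $\sqsubseteq,|{\le}|$ binary relations). The canonical term of $e$ is $\underline{e}$, and $\underline{w^\frown d}$ is $S_d(\underline{w})$ for $d\in\{1,2\}$. Axioms: (VW1) $\neg\,\underline{s}=\underline{t}$ for distinct $s,t\in\Sigma^*$; (VW2) $S_d(\underline{t})=\underline{t^\frown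 d}$ for $t\in\Sigma^*$, $d=1,2$; (VW3) $\underline{e}\sqsubseteq\underline{t}$ for $t\in\Sigma^*$; (VW4) $\forall x(x\sqsubseteq\underline{e}\to x=\underline{e})$; (VW5) $\forall x(x\sqsubseteq S_d(\underline{t})\leftrightarrow x\sqsubseteq\underline{t}\vee x=S_d(\underline{t}))$ for $t\in\Sigma^*$, $d=1,2$; (VW6) $\forall x(x\,|{\le}|\,\underline{2^m}\leftrightarrow\bigvee_{lh(s)\le m}x=\underline{s})$ for $m\ge0$; (VW7) $\exists y\,(y\,|{\le}|\,\underline{t})\to\forall x(x\sqsubseteq\underline{t}\ \&\ x\ne\underline{e}\to\underline{2}\sqsubseteq f(x))$ for $t\in\Sigma^*$; (VW8) $f(\underline{t})=\underline{t^{ -1}}$ for $t\in\Sigma^*$; (VW9) $\forall x,y(f(x)=f(y)\to x=y)$; (VW10) $\forall x,y(x\sqsubseteq y\ \&\ y\sqsubseteq x\to x=y)$. -}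

module Defs where

open import Data.Bool.Base using (Bool)
open import Data.Fin.Base using (Fin; zero; suc; _↑ˡ_; _↑ʳ_)
open import Data.List.Base using
  (List; []; _∷_; _++_; _∷ʳ_; map; foldr; foldl; inits; replicate; reverse; tabulate)
open import Data.List.Membership.Propositional using (_∈_)
open import Data.List.NonEmpty.Base using (List⁺; _∷_; _⁺++⁺_)
open import Data.Nat.Base using (ℕ; zero; suc; _+_)
open import Data.Vec.Base as Vec using (Vec; []; _∷_)
open import Function.Base using (id; _∘_)
open import Relation.Binary.PropositionalEquality.Core using (_≢_)

infix  30 _≐_
infixr 28 _∧_
infixr 27 _∨_
infixr 26 _⇒_

------------------------------------------------------------------------
-- First-order languages with identity

record Signature : Set₁ where
  field
    Fun : ℕ → Set
    Rel : ℕ → Set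

open Signature public

-- Terms and formulas whose free (de Bruijn) variables are indexed by Fin n.
data Term (Σ : Signature) (n : ℕ) : Set where
  var : Fin n → Term Σ n
  fun : ∀ {k} → Fun Σ k → Vec (Term Σ n) k → Term Σ n

data Formula (Σ : Signature) (n : ℕ) : Set where
  rel  : ∀ {k} → Rel Σ k → Vec (Term Σ n) k → Formula Σ n
  _≐_  : Term Σ n → Term Σ n → Formula Σ n
  ⊥̇    : Formula Σ n
  _⇒_  : Formula Σ n → Formula Σ n → Formula Σ n
  _∧_  : Formula Σ n → Formula Σ n → Formula Σ n
  _∨_  : Formula Σ n → Formula Σ n → Formula Σ n
  ∀̇ : Formula Σ (suc n) → Formula Σ n
  ∃̇  : Formula Σ (suc n) → Formula Σ n

Sentence : Signature → Set
Sentence Σ = Formula Σ 0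

module _ {Σ : Signature} where

  ¬̇_ : ∀ {n} → Formula Σ n → Formula Σ n
  ¬̇ φ = φ ⇒ ⊥̇

  _⇔_ : ∀ {n} → Formula Σ n → Formula Σ n → Formula Σ n
  φ ⇔ ψ = (φ ⇒ ψ) ∧ (ψ ⇒ φ)

  ⋁ : ∀ {n} → List (Formula Σ n) → Formula Σ n
  ⋁ = foldr _∨_ ⊥̇

  ⋀ : ∀ {n} → List (Formula Σ n) → Formula Σ n
  ⋀ = foldr _∧_ (⊥̇ ⇒ ⊥̇)

  ∀-closure : ∀ {n} → Formula Σ n → Sentence Σ
  ∀-closure {zero}  φ = φ
  ∀-closure {suc n} φ = ∀-closure (∀̇ φ)

  infix 29 ¬̇_
  infix 25 _⇔_

------------------------------------------------------------------------
-- Renaming and substitution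

liftᵣ : ∀ {m n} → (Fin m → Fin n) → Fin (suc m) → Fin (suc n)
liftᵣ ρ zero    = zero
liftᵣ ρ (suc i) = suc (ρ i)

module _ {Σ : Signature} where

  mutual
    renameₜ : ∀ {m n} → (Fin m → Fin n) → Term Σ m → Term Σ n
    renameₜ ρ (var i)    = var (ρ i)
    renameₜ ρ (fun F ts) = fun F (renameₜₛ ρ ts)

    renameₜₛ : ∀ {m n k} → (Fin m → Fin n) → Vec (Term Σ m) k → Vec (Term Σ n) k
    renameₜₛ ρ []       = []
    renameₜₛ ρ (t ∷ ts) = renameₜ ρ t ∷ renameₜₛ ρ ts

  rename : ∀ {m n} → (Fin m → Fin n) → Formula Σ m → Formula Σ n
  rename ρ (rel R ts) = rel R (renameₜₛ ρ ts)
  rename ρ (t ≐ u)    = renameₜ ρ t ≐ renameₜ ρ u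
  rename ρ ⊥̇          = ⊥̇
  rename ρ (φ ⇒ ψ)    = rename ρ φ ⇒ rename ρ ψ
  rename ρ (φ ∧ ψ)    = rename ρ φ ∧ rename ρ ψ
  rename ρ (φ ∨ ψ)    = rename ρ φ ∨ rename ρ ψ
  rename ρ (∀̇ φ)   = ∀̇ (rename (liftᵣ ρ) φ)
  rename ρ (∃̇ φ)    = ∃̇ (rename (liftᵣ ρ) φ)

  liftₛ : ∀ {m n} → (Fin m → Term Σ n) → Fin (suc m) → Term Σ (suc n)
  liftₛ σ zero    = var zero
  liftₛ σ (suc i) = renameₜ suc (σ i)

  mutual
    substₜ : ∀ {m n} → (Fin m → Term Σ n) → Term Σ m → Term Σ n
    substₜ σ (var i)    = σ i
    substₜ σ (fun F ts) = fun F (substₜₛ σ ts)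

    substₜₛ : ∀ {m n k} → (Fin m → Term Σ n) → Vec (Term Σ m) k → Vec (Term Σ n) k
    substₜₛ σ []       = []
    substₜₛ σ (t ∷ ts) = substₜ σ t ∷ substₜₛ σ ts

  subst : ∀ {m n} → (Fin m → Term Σ n) → Formula Σ m → Formula Σ n
  subst σ (rel R ts) = rel R (substₜₛ σ ts)
  subst σ (t ≐ u)    = substₜ σ t ≐ substₜ σ u
  subst σ ⊥̇          = ⊥̇
  subst σ (φ ⇒ ψ)    = subst σ φ ⇒ subst σ ψ
  subst σ (φ ∧ ψ)    = subst σ φ ∧ subst σ ψ
  subst σ (φ ∨ ψ)    = subst σ φ ∨ subst σ ψ
  subst σ (∀̇ φ)   = ∀̇ (subst (liftₛ σ) φ)
  subst σ (∃̇ φ)    = ∃̇ (subst (liftₛ σ) φ)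

  weaken : ∀ {n} → Formula Σ n → Formula Σ (suc n)
  weaken = rename suc

  instₛ : ∀ {n} → Term Σ n → Fin (suc n) → Term Σ n
  instₛ t zero    = t
  instₛ t (suc i) = var i

  _[_] : ∀ {n} → Formula Σ (suc n) → Term Σ n → Formula Σ n
  φ [ t ] = subst (instₛ t) φ

------------------------------------------------------------------------
-- Theories and classical derivability

-- A theory is given by its set of nonlogical axioms.  The calculus below has
-- no rules for ≐; the identity axioms are to be included in each theory.
Theory : Signature → Set₁
Theory Σ = Sentence Σ → Set

data Identity (Σ : Signature) : Theory Σ where
  reflexive  : Identity Σ (∀̇ (var zero ≐ var zero))
  symmetric  : Identity Σ (∀̇ (∀̇
    (var (suc zero) ≐ var zero ⇒ var zero ≐ var (suc zero))))
  transitive : Identity Σ (∀̇ (∀̇ (∀̇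
    (var (suc (suc zero)) ≐ var (suc zero) ⇒
     var (suc zero) ≐ var zero ⇒
     var (suc (suc zero)) ≐ var zero))))
  fun-cong   : ∀ {k} (F : Fun Σ k) → Identity Σ (∀-closure
    (⋀ (tabulate {n = k} λ i → var (i ↑ˡ k) ≐ var (k ↑ʳ i)) ⇒
     fun F (Vec.tabulate λ i → var (i ↑ˡ k)) ≐
     fun F (Vec.tabulate λ i → var (k ↑ʳ i))))
  rel-cong   : ∀ {k} (R : Rel Σ k) → Identity Σ (∀-closure
    (⋀ (tabulate {n = k} λ i → var (i ↑ˡ k) ≐ var (k ↑ʳ i)) ⇒
     rel R (Vec.tabulate λ i → var (i ↑ˡ k)) ⇒
     rel R (Vec.tabulate λ i → var (k ↑ʳ i))))

infix 4 _∣_⊢_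

-- Natural deduction; in T ∣ Γ ⊢ φ the free variables of Γ and φ are among
-- Fin n.  For n = 0 this does not presuppose a nonempty universe, which makes
-- no difference for a signature with a constant.
data _∣_⊢_ {Σ : Signature} (T : Theory Σ) {n : ℕ} (Γ : List (Formula Σ n)) :
           Formula Σ n → Set where
  axiom : ∀ {φ} → T φ → T ∣ Γ ⊢ rename (λ ()) φ
  hyp   : ∀ {φ} → φ ∈ Γ → T ∣ Γ ⊢ φ
  ⇒I    : ∀ {φ ψ} → T ∣ φ ∷ Γ ⊢ ψ → T ∣ Γ ⊢ φ ⇒ ψ
  ⇒E    : ∀ {φ ψ} → T ∣ Γ ⊢ φ ⇒ ψ → T ∣ Γ ⊢ φ → T ∣ Γ ⊢ ψ
  ∧I    : ∀ {φ ψ} → T ∣ Γ ⊢ φ → T ∣ Γ ⊢ ψ → T ∣ Γ ⊢ φ ∧ ψ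
  ∧E₁   : ∀ {φ ψ} → T ∣ Γ ⊢ φ ∧ ψ → T ∣ Γ ⊢ φ
  ∧E₂   : ∀ {φ ψ} → T ∣ Γ ⊢ φ ∧ ψ → T ∣ Γ ⊢ ψ
  ∨I₁   : ∀ {φ ψ} → T ∣ Γ ⊢ φ → T ∣ Γ ⊢ φ ∨ ψ
  ∨I₂   : ∀ {φ ψ} → T ∣ Γ ⊢ ψ → T ∣ Γ ⊢ φ ∨ ψ
  ∨E    : ∀ {φ ψ χ} → T ∣ Γ ⊢ φ ∨ ψ → T ∣ φ ∷ Γ ⊢ χ → T ∣ ψ ∷ Γ ⊢ χ → T ∣ Γ ⊢ χ
  ∀I    : ∀ {φ} → T ∣ map weaken Γ ⊢ φ → T ∣ Γ ⊢ ∀̇ φ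
  ∀E    : ∀ {φ} → T ∣ Γ ⊢ ∀̇ φ → (t : Term Σ n) → T ∣ Γ ⊢ φ [ t ]
  ∃I    : ∀ {φ} (t : Term Σ n) → T ∣ Γ ⊢ φ [ t ] → T ∣ Γ ⊢ ∃̇ φ
  ∃E    : ∀ {φ ψ} → T ∣ Γ ⊢ ∃̇ φ → T ∣ φ ∷ map weaken Γ ⊢ weaken ψ → T ∣ Γ ⊢ ψ
  raa   : ∀ {φ} → T ∣ (¬̇ φ) ∷ Γ ⊢ ⊥̇ → T ∣ Γ ⊢ φ

------------------------------------------------------------------------
-- Relative interpretations (one-dimensional, without parameters)

-- In graph F, variable zero is the value and the variables suc i are the
-- arguments.  Identity may be translated by any formula.
record Translation (Σ Θ : Signature) : Set where
  field
    domain   : Formula Θ 1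
    identity : Formula Θ 2
    graph    : ∀ {k} → Fun Σ k → Formula Θ (suc k)
    relation : ∀ {k} → Rel Σ k → Formula Θ k

  inDomain : ∀ {n} → Fin n → Formula Θ n
  inDomain i = rename (λ _ → i) domain

  identical : ∀ {n} → Fin n → Fin n → Formula Θ n
  identical i j = rename (Vec.lookup (i ∷ j ∷ [])) identity

  -- Nested terms are eliminated by introducing, for each function symbol, an
  -- existentially quantified value in the domain; a variable stands for
  -- itself.  The continuation receives the variables denoting the values,
  -- in the scope of the quantifiers introduced so far.
  mutual
    evalₜ : ∀ {n m} → Term Σ n → (Fin n → Fin m) →
            (∀ {l} → (Fin m → Fin l) → Fin l → Formula Θ l) → Formula Θ m
    evalₜ (var i)    ρ k = k id (ρ i)
    evalₜ (fun F ts) ρ k = evalₜₛ ts ρ λ ρ′ vs →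
      ∃̇ (inDomain zero ∧
           rename (Vec.lookup (zero ∷ Vec.map suc vs)) (graph F) ∧
           k (suc ∘ ρ′) zero)

    evalₜₛ : ∀ {n m j} → Vec (Term Σ n) j → (Fin n → Fin m) →
             (∀ {l} → (Fin m → Fin l) → Vec (Fin l) j → Formula Θ l) → Formula Θ m
    evalₜₛ []       ρ k = k id []
    evalₜₛ (t ∷ ts) ρ k = evalₜ t ρ λ ρ₁ v →
      evalₜₛ ts (ρ₁ ∘ ρ) λ ρ₂ vs → k (ρ₂ ∘ ρ₁) (ρ₂ v ∷ vs)

  translate : ∀ {n} → Formula Σ n → Formula Θ n
  translate (rel R ts) = evalₜₛ ts id λ _ vs → rename (Vec.lookup vs) (relation R)
  translate (t ≐ u)    = evalₜₛ (t ∷ u ∷ []) id λ _ vs → rename (Vec.lookup vs) identity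
  translate ⊥̇          = ⊥̇
  translate (φ ⇒ ψ)    = translate φ ⇒ translate ψ
  translate (φ ∧ ψ)    = translate φ ∧ translate ψ
  translate (φ ∨ ψ)    = translate φ ∨ translate ψ
  translate (∀̇ φ)   = ∀̇ (inDomain zero ⇒ translate φ)
  translate (∃̇ φ)    = ∃̇ (inDomain zero ∧ translate φ)

-- T Interprets S: S is relatively interpretable in T.
record _Interprets_ {Σ Θ : Signature} (T : Theory Θ) (S : Theory Σ) : Set where
  field
    translation : Translation Σ Θ

  open Translation translation

  field
    domain-nonempty : T ∣ [] ⊢ ∃̇ domain
    graph-total     : ∀ {k} (F : Fun Σ k) →
      T ∣ tabulate {n = k} inDomain ⊢ ∃̇ (inDomain zero ∧ graph F)
    -- The two values are variables 0 and 1, the arguments those from 2 on.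
    graph-unique    : ∀ {k} (F : Fun Σ k) →
      T ∣ tabulate {n = k} (λ i → inDomain (suc (suc i))) ⊢
        (inDomain zero ⇒ inDomain (suc zero) ⇒
         rename (liftᵣ suc) (graph F) ⇒ rename suc (graph F) ⇒
         identical zero (suc zero))
    axioms          : ∀ {φ} → S φ → T ∣ [] ⊢ translate φ

infix 4 _Interprets_

------------------------------------------------------------------------
-- The theory WD_R

-- The set B*
BinaryString : Set
BinaryString = List⁺ Bool

initialSegments : BinaryString → List BinaryString
initialSegments (b ∷ bs) = map (b ∷_) (inits bs)

data WDFun : ℕ → Set where
  const : BinaryString → WDFun 0

data WDRel : ℕ → Set where
  ≼ : WDRel 2
  C : WDRel 3

WDSig : Signature
WDSig = record { Fun = WDFun ; Rel = WDRel }

module _ {n : ℕ} where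

  str : BinaryString → Term WDSig n
  str s = fun (const s) []

  _≼̇_ : Term WDSig n → Term WDSig n → Formula WDSig n
  t ≼̇ u = rel ≼ (t ∷ u ∷ [])

  Ċ : Term WDSig n → Term WDSig n → Term WDSig n → Formula WDSig n
  Ċ t u v = rel C (t ∷ u ∷ v ∷ [])

  infix 30 _≼̇_

data WD-R : Theory WDSig where
  identity : ∀ {φ} → Identity WDSig φ → WD-R φ
  wd1 : ∀ s t → WD-R (Ċ (str s) (str t) (str (s ⁺++⁺ t)))
  wd2 : ∀ s t → s ≢ t → WD-R (¬̇ (str s ≐ str t))
  wd3 : ∀ t → WD-R (∀̇
    (var zero ≼̇ str t ⇔ ⋁ (map (λ s → var zero ≐ str s) (initialSegments t))))
  wd4 : WD-R (∀̇ (∀̇ (∃̇ (Ċ (var (suc (suc zero))) (var (suc zero)) (var zero)))))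
  wd5 : WD-R
    (let x = var (suc (suc (suc zero)))
         y = var (suc (suc zero))
         u = var (suc zero)
         v = var zero
     in ∀̇ (∀̇ (∀̇ (∀̇ (Ċ x y u ∧ Ċ x y v ⇒ u ≐ v)))))

------------------------------------------------------------------------
-- The theory VW⁺

data Digit : Set where
  𝟏 𝟐 : Digit

-- The set Σ*, with the letters of a word listed from left to right
Word : Set
Word = List Digit

-- The words of length at most m
wordsUpTo : ℕ → List Word
wordsUpTo zero    = [] ∷ []
wordsUpTo (suc m) = [] ∷ map (𝟏 ∷_) (wordsUpTo m) ++ map (𝟐 ∷_) (wordsUpTo m)

data VWFun : ℕ → Set where
  e : VWFun 0
  S : Digit → VWFun 1
  f : VWFun 1

data VWRel : ℕ → Set where
  ⊑ |≤| : VWRel 2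

VWSig : Signature
VWSig = record { Fun = VWFun ; Rel = VWRel }

module _ {n : ℕ} where

  ė : Term VWSig n
  ė = fun e []

  Ṡ : Digit → Term VWSig n → Term VWSig n
  Ṡ d t = fun (S d) (t ∷ [])

  ḟ : Term VWSig n → Term VWSig n
  ḟ t = fun f (t ∷ [])

  _⊑̇_ : Term VWSig n → Term VWSig n → Formula VWSig n
  t ⊑̇ u = rel ⊑ (t ∷ u ∷ [])

  _|≤̇|_ : Term VWSig n → Term VWSig n → Formula VWSig n
  t |≤̇| u = rel |≤| (t ∷ u ∷ [])

  -- The last letter of the word becomes the outermost function symbol.
  canonical : Word → Term VWSig n
  canonical = foldl (λ t d → Ṡ d t) ė

  infix 30 _⊑̇_ _|≤̇|_

data VW⁺ : Theory VWSig where
  identity : ∀ {φ} → Identity VWSig φ → VW⁺ φ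
  vw1  : ∀ s t → s ≢ t → VW⁺ (¬̇ (canonical s ≐ canonical t))
  vw2  : ∀ t d → VW⁺ (Ṡ d (canonical t) ≐ canonical (t ∷ʳ d))
  vw3  : ∀ t → VW⁺ (ė ⊑̇ canonical t)
  vw4  : VW⁺ (∀̇ (var zero ⊑̇ ė ⇒ var zero ≐ ė))
  vw5  : ∀ t d → VW⁺ (∀̇
    (var zero ⊑̇ Ṡ d (canonical t) ⇔
     var zero ⊑̇ canonical t ∨ var zero ≐ Ṡ d (canonical t)))
  vw6  : ∀ m → VW⁺ (∀̇
    (var zero |≤̇| canonical (replicate m 𝟐) ⇔
     ⋁ (map (λ s → var zero ≐ canonical s) (wordsUpTo m))))
  vw7  : ∀ t → VW⁺
    (∃̇ (var zero |≤̇| canonical t) ⇒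
     ∀̇ (var zero ⊑̇ canonical t ∧ ¬̇ (var zero ≐ ė) ⇒
           canonical (𝟐 ∷ []) ⊑̇ ḟ (var zero)))
  vw8  : ∀ t → VW⁺ (ḟ (canonical t) ≐ canonical (reverse t))
  vw9  : VW⁺ (∀̇ (∀̇
    (ḟ (var (suc zero)) ≐ ḟ (var zero) ⇒ var (suc zero) ≐ var zero)))
  vw10 : VW⁺ (∀̇ (∀̇
    (var (suc zero) ⊑̇ var zero ∧ var zero ⊑̇ var (suc zero) ⇒
     var (suc zero) ≐ var zero)))

-- The domain is everything and a string is named by its copy over {1,2}; the
-- point is to define concatenation by a formula whose value at standard
-- arguments is provably unique, although nothing is known of nonstandard
-- elements.  The word st is the only z of length |s| + |t| with s ⊑ z and
-- f t ⊑ f z, so it suffices to define the tally b = 2^(|s|+1+|t|): then z |≤| b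
-- makes z standard.  The tally is found in three steps, s, t ↦ 2^|t| ↦ s12^|t| ↦
-- b, each of which seeks, among a, a2, a22, …, the first word with a property
-- that is decided at standard words.  A solution of such a search is required
-- to have every earlier member of the chain as an initial segment; a
-- nonstandard one would have the right standard word strictly below it,
-- contradicting minimality.  Finally C is made total and single-valued by
-- taking a default value wherever the formula does not define exactly one z.

module Submission where

open import Defs
open import Data.Bool.Base using (Bool; true; false)
open import Data.Fin using (#_)
open import Data.Fin.Base using (Fin; zero; suc; _↑ˡ_; _↑ʳ_; splitAt)
open import Data.Fin.Properties using (splitAt-↑ˡ; splitAt-↑ʳ)
open import Data.List.Base using
  (List; []; _∷_; _++_; _∷ʳ_; map; tabulate; foldl; inits; length; replicate; reverse)
open import Data.List.Membership.Propositional using (_∈_)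
open import Data.List.Membership.Propositional.Properties using
  (∈-map⁺; ∈-map⁻; ∈-++⁺ˡ; ∈-++⁺ʳ; ∈-++⁻)
open import Data.List.NonEmpty.Base using (_∷_; _⁺++⁺_; toList)
open import Data.List.Properties using
  (≡-dec; ++-identityʳ; ++-assoc; length-++; length-replicate; length-reverse; map-++;
   map-injective; reverse-++; reverse-injective; ∷-injectiveˡ; ∷-injectiveʳ)
open import Data.List.Relation.Unary.Any using (here; there)
open import Data.List.Reverse using (Reverse; reverseView; []; _∶_∶ʳ_)
open import Data.Nat.Base using (ℕ; zero; suc; _+_; _≤_; _<_; z≤n; s≤s)
open import Data.Nat.Properties using
  (+-suc; +-identityʳ; +-comm; +-cancelˡ-≡; suc-injective; ≤-reflexive; <⇒≱; m<m+n; n≤1+n)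
open import Data.Product.Base using (_,_; _×_; ∃-syntax)
open import Data.Sum.Base using (_⊎_; inj₁; inj₂; [_,_]′)
open import Data.Vec.Base as Vec using (Vec; []; _∷_)
open import Function.Base using (id; _∘_)
open import Relation.Binary.Definitions using (DecidableEquality)
open import Relation.Binary.PropositionalEquality.Core as ≡ using
  (_≡_; _≢_; refl; sym; trans; cong; cong₂)
open import Relation.Nullary.Decidable using (yes; no)
open import Relation.Nullary.Negation using (contradiction)

-- Renaming and substitution

module _ {Σ : Signature} where

  mutual
    renameₜ≡substₜ : ∀ {m n} {ρ : Fin m → Fin n} {σ : Fin m → Term Σ n} →
      (∀ i → var (ρ i) ≡ σ i) → ∀ t → renameₜ ρ t ≡ substₜ σ t
    renameₜ≡substₜ h (var i)    = h i
    renameₜ≡substₜ h (fun F ts) = cong (fun F) (renameₜₛ≡substₜₛ h ts)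

    renameₜₛ≡substₜₛ : ∀ {m n k} {ρ : Fin m → Fin n} {σ : Fin m → Term Σ n} →
      (∀ i → var (ρ i) ≡ σ i) → (ts : Vec _ k) → renameₜₛ ρ ts ≡ substₜₛ σ ts
    renameₜₛ≡substₜₛ h []       = refl
    renameₜₛ≡substₜₛ h (t ∷ ts) = cong₂ _∷_ (renameₜ≡substₜ h t) (renameₜₛ≡substₜₛ h ts)

  liftₛ-var : ∀ {m n} {ρ : Fin m → Fin n} {σ : Fin m → Term Σ n} →
    (∀ i → var (ρ i) ≡ σ i) → ∀ i → var (liftᵣ ρ i) ≡ liftₛ σ i
  liftₛ-var h zero    = refl
  liftₛ-var h (suc i) = cong (renameₜ suc) (h i)

  -- As renaming is a case of substitution, the mixed fusion laws for formulas below reduce to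
  -- `subst-subst`. All these laws take pointwise hypotheses, the form in which they pass under a
  -- binder by lifting.
  rename≡subst : ∀ {m n} {ρ : Fin m → Fin n} {σ : Fin m → Term Σ n} →
    (∀ i → var (ρ i) ≡ σ i) → ∀ φ → rename ρ φ ≡ subst σ φ
  rename≡subst h (rel R ts) = cong (rel R) (renameₜₛ≡substₜₛ h ts)
  rename≡subst h (t ≐ u)    = cong₂ _≐_ (renameₜ≡substₜ h t) (renameₜ≡substₜ h u)
  rename≡subst h ⊥̇          = refl
  rename≡subst h (φ ⇒ ψ)    = cong₂ _⇒_ (rename≡subst h φ) (rename≡subst h ψ)
  rename≡subst h (φ ∧ ψ)    = cong₂ _∧_ (rename≡subst h φ) (rename≡subst h ψ)
  rename≡subst h (φ ∨ ψ)    = cong₂ _∨_ (rename≡subst h φ) (rename≡subst h ψ)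
  rename≡subst h (∀̇ φ)      = cong ∀̇ (rename≡subst (liftₛ-var h) φ)
  rename≡subst h (∃̇ φ)      = cong ∃̇ (rename≡subst (liftₛ-var h) φ)

  mutual
    substₜ-renameₜ : ∀ {l m n} {ρ : Fin l → Fin m} {σ : Fin m → Term Σ n} {τ} →
      (∀ i → σ (ρ i) ≡ τ i) → ∀ t → substₜ σ (renameₜ ρ t) ≡ substₜ τ t
    substₜ-renameₜ h (var i)    = h i
    substₜ-renameₜ h (fun F ts) = cong (fun F) (substₜₛ-renameₜₛ h ts)

    substₜₛ-renameₜₛ : ∀ {l m n k} {ρ : Fin l → Fin m} {σ : Fin m → Term Σ n} {τ} →
      (∀ i → σ (ρ i) ≡ τ i) → (ts : Vec _ k) → substₜₛ σ (renameₜₛ ρ ts) ≡ substₜₛ τ ts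
    substₜₛ-renameₜₛ h []       = refl
    substₜₛ-renameₜₛ h (t ∷ ts) = cong₂ _∷_ (substₜ-renameₜ h t) (substₜₛ-renameₜₛ h ts)

  mutual
    substₜ-substₜ : ∀ {l m n} {σ : Fin l → Term Σ m} {τ : Fin m → Term Σ n} {υ} →
      (∀ i → substₜ τ (σ i) ≡ υ i) → ∀ t → substₜ τ (substₜ σ t) ≡ substₜ υ t
    substₜ-substₜ h (var i)    = h i
    substₜ-substₜ h (fun F ts) = cong (fun F) (substₜₛ-substₜₛ h ts)

    substₜₛ-substₜₛ : ∀ {l m n k} {σ : Fin l → Term Σ m} {τ : Fin m → Term Σ n} {υ} →
      (∀ i → substₜ τ (σ i) ≡ υ i) → (ts : Vec _ k) → substₜₛ τ (substₜₛ σ ts) ≡ substₜₛ υ ts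
    substₜₛ-substₜₛ h []       = refl
    substₜₛ-substₜₛ h (t ∷ ts) = cong₂ _∷_ (substₜ-substₜ h t) (substₜₛ-substₜₛ h ts)

  liftₛ-substₜ : ∀ {l m n} {σ : Fin l → Term Σ m} {τ : Fin m → Term Σ n} {υ} →
    (∀ i → substₜ τ (σ i) ≡ υ i) → ∀ i → substₜ (liftₛ τ) (liftₛ σ i) ≡ liftₛ υ i
  liftₛ-substₜ h zero = refl
  liftₛ-substₜ {σ = σ} {τ} h (suc i) =
    -- Both sides equal `σ i` under the substitution that applies `τ` and then weakens.
    trans (substₜ-renameₜ (λ _ → refl) (σ i))
    (trans (sym (substₜ-substₜ (λ j → sym (renameₜ≡substₜ (λ _ → refl) (τ j))) (σ i)))
    (trans (sym (renameₜ≡substₜ (λ _ → refl) (substₜ τ (σ i))))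
    (cong (renameₜ suc) (h i))))

  subst-subst : ∀ {l m n} {σ : Fin l → Term Σ m} {τ : Fin m → Term Σ n} {υ} →
    (∀ i → substₜ τ (σ i) ≡ υ i) → ∀ φ → subst τ (subst σ φ) ≡ subst υ φ
  subst-subst h (rel R ts) = cong (rel R) (substₜₛ-substₜₛ h ts)
  subst-subst h (t ≐ u)    = cong₂ _≐_ (substₜ-substₜ h t) (substₜ-substₜ h u)
  subst-subst h ⊥̇          = refl
  subst-subst h (φ ⇒ ψ)    = cong₂ _⇒_ (subst-subst h φ) (subst-subst h ψ)
  subst-subst h (φ ∧ ψ)    = cong₂ _∧_ (subst-subst h φ) (subst-subst h ψ)
  subst-subst h (φ ∨ ψ)    = cong₂ _∨_ (subst-subst h φ) (subst-subst h ψ)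
  subst-subst h (∀̇ φ)      = cong ∀̇ (subst-subst (liftₛ-substₜ h) φ)
  subst-subst h (∃̇ φ)      = cong ∃̇ (subst-subst (liftₛ-substₜ h) φ)

  mutual
    substₜ-var : ∀ {n} {σ : Fin n → Term Σ n} → (∀ i → σ i ≡ var i) → ∀ t → substₜ σ t ≡ t
    substₜ-var h (var i)    = h i
    substₜ-var h (fun F ts) = cong (fun F) (substₜₛ-var h ts)

    substₜₛ-var : ∀ {n k} {σ : Fin n → Term Σ n} → (∀ i → σ i ≡ var i) →
      (ts : Vec _ k) → substₜₛ σ ts ≡ ts
    substₜₛ-var h []       = refl
    substₜₛ-var h (t ∷ ts) = cong₂ _∷_ (substₜ-var h t) (substₜₛ-var h ts)

  liftₛ-id : ∀ {n} {σ : Fin n → Term Σ n} → (∀ i → σ i ≡ var i) → ∀ i → liftₛ σ i ≡ var i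
  liftₛ-id h zero    = refl
  liftₛ-id h (suc i) = cong (renameₜ suc) (h i)

  subst-var : ∀ {n} {σ : Fin n → Term Σ n} → (∀ i → σ i ≡ var i) → ∀ φ → subst σ φ ≡ φ
  subst-var h (rel R ts) = cong (rel R) (substₜₛ-var h ts)
  subst-var h (t ≐ u)    = cong₂ _≐_ (substₜ-var h t) (substₜ-var h u)
  subst-var h ⊥̇          = refl
  subst-var h (φ ⇒ ψ)    = cong₂ _⇒_ (subst-var h φ) (subst-var h ψ)
  subst-var h (φ ∧ ψ)    = cong₂ _∧_ (subst-var h φ) (subst-var h ψ)
  subst-var h (φ ∨ ψ)    = cong₂ _∨_ (subst-var h φ) (subst-var h ψ)
  subst-var h (∀̇ φ)      = cong ∀̇ (subst-var (liftₛ-id h) φ)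
  subst-var h (∃̇ φ)      = cong ∃̇ (subst-var (liftₛ-id h) φ)

  subst-rename : ∀ {l m n} {ρ : Fin l → Fin m} {σ : Fin m → Term Σ n} {τ} →
    (∀ i → σ (ρ i) ≡ τ i) → ∀ φ → subst σ (rename ρ φ) ≡ subst τ φ
  subst-rename {σ = σ} h φ =
    trans (cong (subst σ) (rename≡subst (λ _ → refl) φ)) (subst-subst h φ)

  rename-subst : ∀ {l m n} {σ : Fin l → Term Σ m} {ρ : Fin m → Fin n} {τ} →
    (∀ i → renameₜ ρ (σ i) ≡ τ i) → ∀ φ → rename ρ (subst σ φ) ≡ subst τ φ
  rename-subst {σ = σ} h φ =
    trans (rename≡subst (λ _ → refl) (subst σ φ))
      (subst-subst (λ i → trans (sym (renameₜ≡substₜ (λ _ → refl) (σ i))) (h i)) φ)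

  -- A commuting square rather than a composition law: this is how `weaken` is moved past a lifted
  -- renaming.
  rename-rename : ∀ {k l m n} {ρ : Fin k → Fin l} {ρ′ : Fin l → Fin n}
    {π : Fin k → Fin m} {π′ : Fin m → Fin n} →
    (∀ i → ρ′ (ρ i) ≡ π′ (π i)) → (φ : Formula Σ k) →
    rename ρ′ (rename ρ φ) ≡ rename π′ (rename π φ)
  rename-rename h φ =
    trans (rename≡subst (λ _ → refl) (rename _ φ))
    (trans (subst-rename (λ i → cong var (h i)) φ)
    (trans (sym (subst-rename (λ _ → refl) φ))
    (sym (rename≡subst (λ _ → refl) (rename _ φ)))))

  rename-[] : ∀ {m n} (ρ : Fin m → Fin n) (φ : Formula Σ (suc m)) t →
    rename ρ (φ [ t ]) ≡ rename (liftᵣ ρ) φ [ renameₜ ρ t ]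
  rename-[] ρ φ t = trans (rename-subst h φ) (sym (subst-rename (λ _ → refl) φ))
    where
    h : ∀ i → renameₜ ρ (instₛ t i) ≡ instₛ (renameₜ ρ t) (liftᵣ ρ i)
    h zero    = refl
    h (suc i) = refl

  -- Weakening a quantified formula and instantiating it at the fresh variable gives back its body;
  -- this serves every later passage under a quantifier.
  rename-lift-[var] : ∀ {n} (φ : Formula Σ (suc n)) → rename (liftᵣ suc) φ [ var zero ] ≡ φ
  rename-lift-[var] φ = trans (subst-rename (λ _ → refl) φ) (subst-var h φ)
    where
    h : ∀ i → instₛ (var zero) (liftᵣ suc i) ≡ var i
    h zero    = refl
    h (suc i) = refl

-- Derived rules

module _ {Σ : Signature} {T : Theory Σ} where

  cast : ∀ {n} {Γ : List (Formula Σ n)} {φ ψ} → φ ≡ ψ → T ∣ Γ ⊢ φ → T ∣ Γ ⊢ ψ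
  cast refl d = d

  -- An inclusion into an arbitrary `Δ` replaces the renamed context, so that `weaken-⊢` and
  -- `monotone-⊢` are both instances.
  rename-⊢ : ∀ {m n} (ρ : Fin m → Fin n) {Γ Δ φ} →
    (∀ {ψ} → ψ ∈ Γ → rename ρ ψ ∈ Δ) → T ∣ Γ ⊢ φ → T ∣ Δ ⊢ rename ρ φ
  rename-⊢-lift : ∀ {m n} (ρ : Fin m → Fin n) {Γ Δ} →
    (∀ {ψ} → ψ ∈ Γ → rename ρ ψ ∈ Δ) →
    ∀ {ψ : Formula Σ (suc m)} → ψ ∈ map weaken Γ → rename (liftᵣ ρ) ψ ∈ map weaken Δ
  rename-⊢-keep : ∀ {m n} (ρ : Fin m → Fin n) {Γ Δ χ} →
    (∀ {ψ} → ψ ∈ Γ → rename ρ ψ ∈ Δ) →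
    ∀ {ψ : Formula Σ m} → ψ ∈ χ ∷ Γ → rename ρ ψ ∈ rename ρ χ ∷ Δ

  rename-⊢-lift ρ s p with ∈-map⁻ weaken p
  ... | φ , q , refl =
    ≡.subst (_∈ _) (rename-rename (λ _ → refl) φ) (∈-map⁺ weaken (s q))

  rename-⊢-keep ρ s (here refl) = here refl
  rename-⊢-keep ρ s (there p)   = there (s p)

  rename-⊢ ρ s (axiom {φ} a) = cast
    (sym (trans (rename≡subst (λ _ → refl) (rename _ φ))
      (trans (subst-rename (λ _ → refl) φ) (sym (rename≡subst (λ ()) φ)))))
    (axiom a)
  rename-⊢ ρ s (hyp p)      = hyp (s p)
  rename-⊢ ρ s (⇒I d)       = ⇒I (rename-⊢ ρ (rename-⊢-keep ρ s) d)
  rename-⊢ ρ s (⇒E d d′)    = ⇒E (rename-⊢ ρ s d) (rename-⊢ ρ s d′)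
  rename-⊢ ρ s (∧I d d′)    = ∧I (rename-⊢ ρ s d) (rename-⊢ ρ s d′)
  rename-⊢ ρ s (∧E₁ d)      = ∧E₁ (rename-⊢ ρ s d)
  rename-⊢ ρ s (∧E₂ d)      = ∧E₂ (rename-⊢ ρ s d)
  rename-⊢ ρ s (∨I₁ d)      = ∨I₁ (rename-⊢ ρ s d)
  rename-⊢ ρ s (∨I₂ d)      = ∨I₂ (rename-⊢ ρ s d)
  rename-⊢ ρ s (∨E d d₁ d₂) = ∨E (rename-⊢ ρ s d)
    (rename-⊢ ρ (rename-⊢-keep ρ s) d₁) (rename-⊢ ρ (rename-⊢-keep ρ s) d₂)
  rename-⊢ ρ s (∀I d)       = ∀I (rename-⊢ (liftᵣ ρ) (rename-⊢-lift ρ s) d)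
  rename-⊢ ρ s (∀E {φ} d t) = cast (sym (rename-[] ρ φ t)) (∀E (rename-⊢ ρ s d) (renameₜ ρ t))
  rename-⊢ ρ s (∃I {φ} t d) = ∃I (renameₜ ρ t) (cast (rename-[] ρ φ t) (rename-⊢ ρ s d))
  rename-⊢ ρ s (∃E {φ} {ψ} d d′) = ∃E (rename-⊢ ρ s d)
    (cast (rename-rename (λ _ → refl) ψ)
      (rename-⊢ (liftᵣ ρ) (rename-⊢-keep (liftᵣ ρ) (rename-⊢-lift ρ s)) d′))
  rename-⊢ ρ s (raa d)      = raa (rename-⊢ ρ (rename-⊢-keep ρ s) d)

  weaken-⊢ : ∀ {n} {Γ : List (Formula Σ n)} {φ} → T ∣ Γ ⊢ φ → T ∣ map weaken Γ ⊢ weaken φ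
  weaken-⊢ = rename-⊢ suc (∈-map⁺ weaken)

  monotone-⊢ : ∀ {n} {Γ Δ : List (Formula Σ n)} {φ} →
    (∀ {ψ} → ψ ∈ Γ → ψ ∈ Δ) → T ∣ Γ ⊢ φ → T ∣ Δ ⊢ φ
  monotone-⊢ {Γ = Γ} {Δ} {φ} s d = cast (rename-id φ)
    (rename-⊢ id (λ {ψ} p → ≡.subst (_∈ Δ) (sym (rename-id ψ)) (s p)) d)
    where
    rename-id : ∀ ψ → rename id ψ ≡ ψ
    rename-id ψ = trans (rename≡subst (λ _ → refl) ψ) (subst-var (λ _ → refl) ψ)

  under-⊢ : ∀ {n} {Γ : List (Formula Σ n)} {φ ψ} → T ∣ Γ ⊢ φ → T ∣ ψ ∷ Γ ⊢ φ
  under-⊢ = monotone-⊢ there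

  ⊥E : ∀ {n} {Γ : List (Formula Σ n)} {φ} → T ∣ Γ ⊢ ⊥̇ → T ∣ Γ ⊢ φ
  ⊥E d = raa (under-⊢ d)

  excluded-middle : ∀ {n} {Γ : List (Formula Σ n)} φ → T ∣ Γ ⊢ φ ∨ ¬̇ φ
  excluded-middle φ =
    raa (⇒E (hyp (here refl)) (∨I₂ (⇒I (⇒E (hyp (there (here refl))) (∨I₁ (hyp (here refl)))))))

  sentence : ∀ {φ} → T φ → T ∣ [] ⊢ φ
  sentence {φ} a =
    cast (trans (rename≡subst (λ ()) φ) (subst-var {σ = var} (λ ()) φ)) (axiom a)

  -- The closure quantifies variable zero innermost: `∀̇ φ` is instantiated at `σ ∘ suc` first, then
  -- its own quantifier at `σ zero`, and the two substitutions fuse to `σ`.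
  ∀-closure-E : ∀ {m n} {Γ : List (Formula Σ m)} (φ : Formula Σ n) →
    T (∀-closure φ) → (σ : Fin n → Term Σ m) → T ∣ Γ ⊢ subst σ φ
  ∀-closure-E φ a = go φ (axiom a)
    where
    go : ∀ {m n} {Γ : List (Formula Σ m)} (φ : Formula Σ n) →
      T ∣ Γ ⊢ rename (λ ()) (∀-closure φ) → (σ : Fin n → Term Σ m) → T ∣ Γ ⊢ subst σ φ
    go {n = zero}  φ d σ = cast (rename≡subst (λ ()) φ) d
    go {n = suc n} φ d σ =
      cast (subst-subst h φ) (∀E (go (∀̇ φ) d (σ ∘ suc)) (σ zero))
      where
      h : ∀ i → substₜ (instₛ (σ zero)) (liftₛ (σ ∘ suc) i) ≡ σ i
      h zero    = refl
      h (suc i) = trans (substₜ-renameₜ (λ _ → refl) (σ (suc i))) (substₜ-var (λ _ → refl) (σ (suc i)))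

-- Equality

module Equality {Σ : Signature} {T : Theory Σ} (identity⁺ : ∀ {φ} → Identity Σ φ → T φ) where

  module _ {n : ℕ} {Γ : List (Formula Σ n)} where

    ≐-refl : ∀ t → T ∣ Γ ⊢ t ≐ t
    ≐-refl t = ∀-closure-E {n = 1} (var zero ≐ var zero) (identity⁺ reflexive) (λ _ → t)

    ≐-sym : ∀ {t u} → T ∣ Γ ⊢ t ≐ u → T ∣ Γ ⊢ u ≐ t
    ≐-sym {t} {u} = ⇒E (∀-closure-E {n = 2} (var (suc zero) ≐ var zero ⇒ var zero ≐ var (suc zero))
      (identity⁺ symmetric) (Vec.lookup (u ∷ t ∷ [])))

    ≐-trans : ∀ {t u v} → T ∣ Γ ⊢ t ≐ u → T ∣ Γ ⊢ u ≐ v → T ∣ Γ ⊢ t ≐ v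
    ≐-trans {t} {u} {v} p q = ⇒E (⇒E (∀-closure-E {n = 3}
      (var (suc (suc zero)) ≐ var (suc zero) ⇒ var (suc zero) ≐ var zero ⇒
       var (suc (suc zero)) ≐ var zero)
      (identity⁺ transitive) (Vec.lookup (v ∷ u ∷ t ∷ []))) p) q

    private
      -- The variables of a congruence axiom form two blocks of size `k`; the left block receives
      -- `s` and the right one `t`.
      pairwise : ∀ {k} → (Fin k → Term Σ n) → (Fin k → Term Σ n) → Fin (k + k) → Term Σ n
      pairwise {k} s t = [ s , t ]′ ∘ splitAt k

      substₜₛ-tabulate : ∀ {m k} {σ : Fin m → Term Σ n} (s : Fin k → Fin m) (ts : Vec (Term Σ n) k) →
        (∀ i → σ (s i) ≡ Vec.lookup ts i) → substₜₛ σ (Vec.tabulate (var ∘ s)) ≡ ts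
      substₜₛ-tabulate s []       h = refl
      substₜₛ-tabulate s (t ∷ ts) h = cong₂ _∷_ (h zero) (substₜₛ-tabulate (s ∘ suc) ts (h ∘ suc))

      ⋀-intro : ∀ {m k} {σ : Fin m → Term Σ n} (φ : Fin k → Formula Σ m) →
        (∀ i → T ∣ Γ ⊢ subst σ (φ i)) → T ∣ Γ ⊢ subst σ (⋀ (tabulate φ))
      ⋀-intro {k = zero}  φ d = ⇒I (hyp (here refl))
      ⋀-intro {k = suc k} φ d = ∧I (d zero) (⋀-intro (φ ∘ suc) (d ∘ suc))

    module _ {k : ℕ} {ts us : Vec (Term Σ n) k}
             (d : ∀ i → T ∣ Γ ⊢ Vec.lookup ts i ≐ Vec.lookup us i) where

      private
        σ : Fin (k + k) → Term Σ n
        σ = pairwise (Vec.lookup ts) (Vec.lookup us)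

        σ-left : ∀ i → σ (i ↑ˡ k) ≡ Vec.lookup ts i
        σ-left i = cong [ _ , _ ]′ (splitAt-↑ˡ k i k)

        σ-right : ∀ i → σ (k ↑ʳ i) ≡ Vec.lookup us i
        σ-right i = cong [ _ , _ ]′ (splitAt-↑ʳ k k i)

        premise : T ∣ Γ ⊢ subst σ (⋀ (tabulate {n = k} λ i → var (i ↑ˡ k) ≐ var (k ↑ʳ i)))
        premise = ⋀-intro _ λ i → cast (sym (cong₂ _≐_ (σ-left i) (σ-right i))) (d i)

      ≐-fun : ∀ F → T ∣ Γ ⊢ fun F ts ≐ fun F us
      ≐-fun F = cast
        (cong₂ (λ ts us → fun F ts ≐ fun F us)
          (substₜₛ-tabulate _ ts σ-left) (substₜₛ-tabulate _ us σ-right))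
        (⇒E (∀-closure-E _ (identity⁺ (fun-cong F)) σ) premise)

      ≐-rel : ∀ R → T ∣ Γ ⊢ rel R ts → T ∣ Γ ⊢ rel R us
      ≐-rel R = ⇒E (cast
        (cong₂ (λ ts us → rel R ts ⇒ rel R us)
          (substₜₛ-tabulate _ ts σ-left) (substₜₛ-tabulate _ us σ-right))
        (⇒E (∀-closure-E _ (identity⁺ (rel-cong R)) σ) premise))

  mutual
    ≐-substₜ : ∀ {m n} {Γ : List (Formula Σ n)} {σ τ : Fin m → Term Σ n} →
      (∀ i → T ∣ Γ ⊢ σ i ≐ τ i) → ∀ t → T ∣ Γ ⊢ substₜ σ t ≐ substₜ τ t
    ≐-substₜ d (var i)    = d i
    ≐-substₜ d (fun F ts) = ≐-fun (≐-substₜₛ d ts) F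

    ≐-substₜₛ : ∀ {m n k} {Γ : List (Formula Σ n)} {σ τ : Fin m → Term Σ n} →
      (∀ i → T ∣ Γ ⊢ σ i ≐ τ i) → (ts : Vec _ k) →
      ∀ i → T ∣ Γ ⊢ Vec.lookup (substₜₛ σ ts) i ≐ Vec.lookup (substₜₛ τ ts) i
    ≐-substₜₛ d (t ∷ ts) zero    = ≐-substₜ d t
    ≐-substₜₛ d (t ∷ ts) (suc i) = ≐-substₜₛ d ts i

  ≐-liftₛ : ∀ {m n} {Γ : List (Formula Σ n)} {σ τ : Fin m → Term Σ n} →
    (∀ i → T ∣ Γ ⊢ σ i ≐ τ i) → ∀ i → T ∣ map weaken Γ ⊢ liftₛ σ i ≐ liftₛ τ i
  ≐-liftₛ d zero    = ≐-refl _
  ≐-liftₛ d (suc i) = weaken-⊢ (d i)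

  leibniz : ∀ {m n} {Γ : List (Formula Σ n)} {σ τ : Fin m → Term Σ n} →
    (∀ i → T ∣ Γ ⊢ σ i ≐ τ i) → ∀ φ → T ∣ Γ ⊢ subst σ φ → T ∣ Γ ⊢ subst τ φ
  leibniz d (rel R ts) p = ≐-rel (≐-substₜₛ d ts) R p
  leibniz d (t ≐ u) p    = ≐-trans (≐-sym (≐-substₜ d t)) (≐-trans p (≐-substₜ d u))
  leibniz d ⊥̇ p          = p
  -- The antecedent is contravariant, so it is transported along the reversed equations.
  leibniz d (φ ⇒ ψ) p    = ⇒I (leibniz (under-⊢ ∘ d) ψ
    (⇒E (under-⊢ p) (leibniz (≐-sym ∘ under-⊢ ∘ d) φ (hyp (here refl)))))
  leibniz d (φ ∧ ψ) p    = ∧I (leibniz d φ (∧E₁ p)) (leibniz d ψ (∧E₂ p))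
  leibniz d (φ ∨ ψ) p    = ∨E p (∨I₁ (leibniz (under-⊢ ∘ d) φ (hyp (here refl))))
                                (∨I₂ (leibniz (under-⊢ ∘ d) ψ (hyp (here refl))))
  leibniz d (∀̇ φ) p      = ∀I (leibniz (≐-liftₛ d) φ
    (cast (rename-lift-[var] _) (∀E (weaken-⊢ p) (var zero))))
  leibniz d (∃̇ φ) p      = ∃E p (∃I (var zero) (cast (sym (rename-lift-[var] _))
    (leibniz (under-⊢ ∘ ≐-liftₛ d) φ (hyp (here refl)))))

  replace : ∀ {n} {Γ : List (Formula Σ n)} {t u} φ →
    T ∣ Γ ⊢ t ≐ u → T ∣ Γ ⊢ φ [ t ] → T ∣ Γ ⊢ φ [ u ]
  replace φ d = leibniz (λ { zero → d ; (suc i) → ≐-refl _ }) φ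

  -- Since `α` pins the witness down to `t`, replacing equals turns the existential into its
  -- instance. This removes intermediate values, both in `Concat` and in translated constants.
  ∃-unique : ∀ {n} {Γ : List (Formula Σ n)} {t} α φ → T ∣ Γ ⊢ ∃̇ (α ∧ φ) →
    (∀ {Δ} → T ∣ α ∷ Δ ⊢ var zero ≐ renameₜ suc t) → T ∣ Γ ⊢ φ [ t ]
  ∃-unique {t = t} α φ p u = ∃E p (cast (sym (rename-[] suc φ t))
    (replace (rename (liftᵣ suc) φ)
      (⇒E (⇒I (u {_})) (∧E₁ (hyp (here refl))))
      (cast (sym (rename-lift-[var] φ)) (∧E₂ (hyp (here refl))))))

-- Constants for words

data Fun⁺ : ℕ → Set where
  old  : ∀ {k} → VWFun k → Fun⁺ k
  word : Word → Fun⁺ 0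

-- A canonical term with a variable word is a stuck foldl, on which renaming
-- and substitution do not compute; on the constants naming words they do.
VWSig⁺ : Signature
VWSig⁺ = record { Fun = Fun⁺ ; Rel = VWRel }

substₜ-canonical : ∀ {m n} (σ : Fin m → Term VWSig n) w → substₜ σ (canonical w) ≡ canonical w
substₜ-canonical σ = go ė
  where
  go : ∀ t w → substₜ σ (foldl (λ t d → Ṡ d t) t w) ≡ foldl (λ t d → Ṡ d t) (substₜ σ t) w
  go t []      = refl
  go t (d ∷ w) = go (Ṡ d t) w

mutual
  ⌜_⌝ₜ : ∀ {n} → Term VWSig⁺ n → Term VWSig n
  ⌜ var i ⌝ₜ           = var i
  ⌜ fun (old F) ts ⌝ₜ  = fun F ⌜ ts ⌝ₜₛ
  ⌜ fun (word w) ts ⌝ₜ = canonical w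

  ⌜_⌝ₜₛ : ∀ {n k} → Vec (Term VWSig⁺ n) k → Vec (Term VWSig n) k
  ⌜ [] ⌝ₜₛ     = []
  ⌜ t ∷ ts ⌝ₜₛ = ⌜ t ⌝ₜ ∷ ⌜ ts ⌝ₜₛ

⌜_⌝ : ∀ {n} → Formula VWSig⁺ n → Formula VWSig n
⌜ rel R ts ⌝ = rel R ⌜ ts ⌝ₜₛ
⌜ t ≐ u ⌝    = ⌜ t ⌝ₜ ≐ ⌜ u ⌝ₜ
⌜ ⊥̇ ⌝        = ⊥̇
⌜ φ ⇒ ψ ⌝    = ⌜ φ ⌝ ⇒ ⌜ ψ ⌝
⌜ φ ∧ ψ ⌝    = ⌜ φ ⌝ ∧ ⌜ ψ ⌝
⌜ φ ∨ ψ ⌝    = ⌜ φ ⌝ ∨ ⌜ ψ ⌝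
⌜ ∀̇ φ ⌝      = ∀̇ ⌜ φ ⌝
⌜ ∃̇ φ ⌝      = ∃̇ ⌜ φ ⌝

mutual
  ⌜substₜ⌝ : ∀ {m n} {σ : Fin m → Term VWSig⁺ n} {τ} → (∀ i → ⌜ σ i ⌝ₜ ≡ τ i) →
    ∀ t → ⌜ substₜ σ t ⌝ₜ ≡ substₜ τ ⌜ t ⌝ₜ
  ⌜substₜ⌝ h (var i)           = h i
  ⌜substₜ⌝ h (fun (old F) ts)  = cong (fun F) (⌜substₜₛ⌝ h ts)
  ⌜substₜ⌝ h (fun (word w) ts) = sym (substₜ-canonical _ w)

  ⌜substₜₛ⌝ : ∀ {m n k} {σ : Fin m → Term VWSig⁺ n} {τ} → (∀ i → ⌜ σ i ⌝ₜ ≡ τ i) →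
    (ts : Vec _ k) → ⌜ substₜₛ σ ts ⌝ₜₛ ≡ substₜₛ τ ⌜ ts ⌝ₜₛ
  ⌜substₜₛ⌝ h []       = refl
  ⌜substₜₛ⌝ h (t ∷ ts) = cong₂ _∷_ (⌜substₜ⌝ h t) (⌜substₜₛ⌝ h ts)

⌜renameₜ⌝ : ∀ {m n} (ρ : Fin m → Fin n) t → ⌜ renameₜ ρ t ⌝ₜ ≡ renameₜ ρ ⌜ t ⌝ₜ
⌜renameₜ⌝ ρ t =
  trans (cong ⌜_⌝ₜ (renameₜ≡substₜ (λ _ → refl) t))
  (trans (⌜substₜ⌝ (λ _ → refl) t) (sym (renameₜ≡substₜ (λ _ → refl) ⌜ t ⌝ₜ)))

⌜liftₛ⌝ : ∀ {m n} {σ : Fin m → Term VWSig⁺ n} {τ} → (∀ i → ⌜ σ i ⌝ₜ ≡ τ i) →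
  ∀ i → ⌜ liftₛ σ i ⌝ₜ ≡ liftₛ τ i
⌜liftₛ⌝ h zero            = refl
⌜liftₛ⌝ {σ = σ} h (suc i) = trans (⌜renameₜ⌝ suc (σ i)) (cong (renameₜ suc) (h i))

⌜subst⌝ : ∀ {m n} {σ : Fin m → Term VWSig⁺ n} {τ} → (∀ i → ⌜ σ i ⌝ₜ ≡ τ i) →
  ∀ φ → ⌜ subst σ φ ⌝ ≡ subst τ ⌜ φ ⌝
⌜subst⌝ h (rel R ts) = cong (rel R) (⌜substₜₛ⌝ h ts)
⌜subst⌝ h (t ≐ u)    = cong₂ _≐_ (⌜substₜ⌝ h t) (⌜substₜ⌝ h u)
⌜subst⌝ h ⊥̇          = refl
⌜subst⌝ h (φ ⇒ ψ)    = cong₂ _⇒_ (⌜subst⌝ h φ) (⌜subst⌝ h ψ)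
⌜subst⌝ h (φ ∧ ψ)    = cong₂ _∧_ (⌜subst⌝ h φ) (⌜subst⌝ h ψ)
⌜subst⌝ h (φ ∨ ψ)    = cong₂ _∨_ (⌜subst⌝ h φ) (⌜subst⌝ h ψ)
⌜subst⌝ h (∀̇ φ)      = cong ∀̇ (⌜subst⌝ (⌜liftₛ⌝ h) φ)
⌜subst⌝ h (∃̇ φ)      = cong ∃̇ (⌜subst⌝ (⌜liftₛ⌝ h) φ)

⌜rename⌝ : ∀ {m n} (ρ : Fin m → Fin n) φ → ⌜ rename ρ φ ⌝ ≡ rename ρ ⌜ φ ⌝
⌜rename⌝ ρ φ =
  trans (cong ⌜_⌝ (rename≡subst (λ _ → refl) φ))
  (trans (⌜subst⌝ (λ _ → refl) φ) (sym (rename≡subst (λ _ → refl) ⌜ φ ⌝)))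

⌜[]⌝ : ∀ {n} (φ : Formula VWSig⁺ (suc n)) t → ⌜ φ [ t ] ⌝ ≡ ⌜ φ ⌝ [ ⌜ t ⌝ₜ ]
⌜[]⌝ φ t = ⌜subst⌝ (λ { zero → refl ; (suc i) → refl }) φ

-- Nonlogical axioms are taken as the preimage under `⌜_⌝`: a formula with named words is an axiom
-- as soon as its expansion is one.
data VW⁺⁺ : Theory VWSig⁺ where
  identity : ∀ {φ} → Identity VWSig⁺ φ → VW⁺⁺ φ
  proper   : ∀ {φ} → VW⁺ ⌜ φ ⌝ → VW⁺⁺ φ

-- Matching on each symbol fixes its arity, after which an identity axiom expands to one of VW⁺.
-- Only congruence for a named word is new, and it expands to an instance of reflexivity.
⌜axiom⌝ : ∀ {φ} → VW⁺⁺ φ → VW⁺ ∣ [] ⊢ ⌜ φ ⌝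
⌜axiom⌝ (identity reflexive)           = sentence (identity reflexive)
⌜axiom⌝ (identity symmetric)           = sentence (identity symmetric)
⌜axiom⌝ (identity transitive)          = sentence (identity transitive)
⌜axiom⌝ (identity (fun-cong (old e)))     = sentence (identity (fun-cong e))
⌜axiom⌝ (identity (fun-cong (old (S d)))) = sentence (identity (fun-cong (S d)))
⌜axiom⌝ (identity (fun-cong (old f)))     = sentence (identity (fun-cong f))
⌜axiom⌝ (identity (fun-cong (word w))) = ⇒I (Equality.≐-refl identity _)
⌜axiom⌝ (identity (rel-cong ⊑))        = sentence (identity (rel-cong ⊑))
⌜axiom⌝ (identity (rel-cong |≤|))      = sentence (identity (rel-cong |≤|))
⌜axiom⌝ (proper a)                     = sentence a

⌜map-weaken⌝ : ∀ {n} (Γ : List (Formula VWSig⁺ n)) →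
  map ⌜_⌝ (map weaken Γ) ≡ map weaken (map ⌜_⌝ Γ)
⌜map-weaken⌝ []      = refl
⌜map-weaken⌝ (φ ∷ Γ) = cong₂ _∷_ (⌜rename⌝ suc φ) (⌜map-weaken⌝ Γ)

-- Expansion commutes with renaming and instantiation, hence preserves every rule. It therefore
-- suffices to derive everything in `VW⁺⁺`.
⌜⊢⌝ : ∀ {n Γ} {φ : Formula VWSig⁺ n} → VW⁺⁺ ∣ Γ ⊢ φ → VW⁺ ∣ map ⌜_⌝ Γ ⊢ ⌜ φ ⌝
⌜⊢⌝ (axiom {φ} a)     = cast (sym (⌜rename⌝ _ φ)) (rename-⊢ _ (λ ()) (⌜axiom⌝ a))
⌜⊢⌝ (hyp p)           = hyp (∈-map⁺ ⌜_⌝ p)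
⌜⊢⌝ (⇒I d)            = ⇒I (⌜⊢⌝ d)
⌜⊢⌝ (⇒E d d′)         = ⇒E (⌜⊢⌝ d) (⌜⊢⌝ d′)
⌜⊢⌝ (∧I d d′)         = ∧I (⌜⊢⌝ d) (⌜⊢⌝ d′)
⌜⊢⌝ (∧E₁ d)           = ∧E₁ (⌜⊢⌝ d)
⌜⊢⌝ (∧E₂ d)           = ∧E₂ (⌜⊢⌝ d)
⌜⊢⌝ (∨I₁ d)           = ∨I₁ (⌜⊢⌝ d)
⌜⊢⌝ (∨I₂ d)           = ∨I₂ (⌜⊢⌝ d)
⌜⊢⌝ (∨E d d₁ d₂)      = ∨E (⌜⊢⌝ d) (⌜⊢⌝ d₁) (⌜⊢⌝ d₂)
⌜⊢⌝ {Γ = Γ} (∀I d)    = ∀I (≡.subst (λ Δ → VW⁺ ∣ Δ ⊢ _) (⌜map-weaken⌝ Γ) (⌜⊢⌝ d))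
⌜⊢⌝ (∀E {φ} d t)      = cast (sym (⌜[]⌝ φ t)) (∀E (⌜⊢⌝ d) ⌜ t ⌝ₜ)
⌜⊢⌝ (∃I {φ} t d)      = ∃I ⌜ t ⌝ₜ (cast (⌜[]⌝ φ t) (⌜⊢⌝ d))
⌜⊢⌝ {Γ = Γ} (∃E {φ} {ψ} d d′) = ∃E (⌜⊢⌝ d)
  (≡.subst₂ (λ Δ χ → VW⁺ ∣ ⌜ φ ⌝ ∷ Δ ⊢ χ) (⌜map-weaken⌝ Γ) (⌜rename⌝ suc ψ) (⌜⊢⌝ d′))
⌜⊢⌝ (raa d)           = raa (⌜⊢⌝ d)

-- Words

_≟_ : DecidableEquality Digit
𝟏 ≟ 𝟏 = yes refl
𝟏 ≟ 𝟐 = no λ ()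
𝟐 ≟ 𝟏 = no λ ()
𝟐 ≟ 𝟐 = yes refl

twos : ℕ → Word
twos k = replicate k 𝟐

twos-∷ʳ : ∀ k → twos k ∷ʳ 𝟐 ≡ twos (suc k)
twos-∷ʳ zero    = refl
twos-∷ʳ (suc k) = cong (𝟐 ∷_) (twos-∷ʳ k)

twos-+ : ∀ j i → twos j ++ twos i ≡ twos (j + i)
twos-+ zero    i = refl
twos-+ (suc j) i = cong (𝟐 ∷_) (twos-+ j i)

reverse-twos : ∀ k → reverse (twos k) ≡ twos k
reverse-twos zero    = refl
reverse-twos (suc k) =
  trans (reverse-++ (𝟐 ∷ []) (twos k)) (trans (cong (_∷ʳ 𝟐) (reverse-twos k)) (twos-∷ʳ k))

twos-injective : ∀ {j k} → twos j ≡ twos k → j ≡ k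
twos-injective {j} {k} eq =
  trans (sym (length-replicate j)) (trans (cong length eq) (length-replicate k))

-- The first 1 marks the end of the leading run of 2's.
twos-𝟏-injective : ∀ j k {x y} → twos j ++ 𝟏 ∷ x ≡ twos k ++ 𝟏 ∷ y → j ≡ k
twos-𝟏-injective zero    zero    eq = refl
twos-𝟏-injective (suc j) (suc k) eq = cong suc (twos-𝟏-injective j k (∷-injectiveʳ eq))

twos-prefix : ∀ u r k → u ++ r ≡ twos k → ∃[ j ] ∃[ i ] j + i ≡ k × u ≡ twos j
twos-prefix []      r k       eq = 0 , k , refl , refl
twos-prefix (c ∷ u) r (suc k) eq with twos-prefix u r k (∷-injectiveʳ eq)
... | j , i , p , q = suc j , i , cong suc p , cong₂ _∷_ (∷-injectiveˡ eq) q

-- Either `u` is long enough to contain `w`, and is then a member of the chain, or it is shorter and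
-- cannot extend `w`. The second case will contradict the demand that the start of a chain lie below
-- `u`.
prefix-twos : ∀ w u r k → u ++ r ≡ w ++ twos k →
  (∃[ j ] ∃[ i ] j + i ≡ k × u ≡ w ++ twos j) ⊎ (∀ x → w ++ x ≢ u)
prefix-twos []      u       r k eq = inj₁ (twos-prefix u r k eq)
prefix-twos (c ∷ w) []      r k eq = inj₂ λ _ ()
prefix-twos (c ∷ w) (d ∷ u) r k eq with prefix-twos w u r k (∷-injectiveʳ eq)
... | inj₁ (j , i , p , q) = inj₁ (j , i , p , cong₂ _∷_ (∷-injectiveˡ eq) q)
... | inj₂ h               = inj₂ λ x eq′ → h x (∷-injectiveʳ eq′)

++-injectiveˡ : ∀ (x y : Word) {u v} → length x ≡ length y → x ++ u ≡ y ++ v → x ≡ y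
++-injectiveˡ []      []      h eq = refl
++-injectiveˡ (c ∷ x) (d ∷ y) h eq =
  cong₂ _∷_ (∷-injectiveˡ eq) (++-injectiveˡ x y (suc-injective h) (∷-injectiveʳ eq))

-- By the length condition the rest `r` after `s` is as long as `t`. The reversals of `r` and `t`
-- are then initial segments of the same word with equal length, so they coincide.
prefix-suffix : ∀ (s t r : Word) {r′ w} → s ++ r ≡ w → reverse t ++ r′ ≡ reverse w →
  length w ≡ length s + length t → w ≡ s ++ t
prefix-suffix s t r refl q h = cong (s ++_) (reverse-injective (sym
  (++-injectiveˡ (reverse t) (reverse r)
    (trans (length-reverse t) (trans (sym |r|≡|t|) (sym (length-reverse r))))
    (trans q (reverse-++ s r)))))
  where
  |r|≡|t| : length r ≡ length t
  |r|≡|t| = +-cancelˡ-≡ (length s) _ _ (trans (sym (length-++ s)) h)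

∈-wordsUpTo⁺ : ∀ {u} m → length u ≤ m → u ∈ wordsUpTo m
∈-wordsUpTo⁺ {[]}    zero    h       = here refl
∈-wordsUpTo⁺ {[]}    (suc m) h       = here refl
∈-wordsUpTo⁺ {𝟏 ∷ u} (suc m) (s≤s h) = there (∈-++⁺ˡ (∈-map⁺ _ (∈-wordsUpTo⁺ m h)))
∈-wordsUpTo⁺ {𝟐 ∷ u} (suc m) (s≤s h) =
  there (∈-++⁺ʳ (map (𝟏 ∷_) (wordsUpTo m)) (∈-map⁺ _ (∈-wordsUpTo⁺ m h)))

∈-wordsUpTo⁻ : ∀ {u} m → u ∈ wordsUpTo m → length u ≤ m
∈-wordsUpTo⁻ zero    (here refl) = z≤n
∈-wordsUpTo⁻ (suc m) (here refl) = z≤n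
∈-wordsUpTo⁻ (suc m) (there p) with ∈-++⁻ (map (𝟏 ∷_) (wordsUpTo m)) p
... | inj₁ q with ∈-map⁻ _ q
...   | _ , r , refl = s≤s (∈-wordsUpTo⁻ m r)
∈-wordsUpTo⁻ (suc m) (there p) | inj₂ q with ∈-map⁻ _ q
...   | _ , r , refl = s≤s (∈-wordsUpTo⁻ m r)

-- Derivations about named words

open Equality {T = VW⁺⁺} identity

module _ {n : ℕ} where

  ⟨_⟩ : Word → Term VWSig⁺ n
  ⟨ w ⟩ = fun (word w) []

  𝕊 : Digit → Term VWSig⁺ n → Term VWSig⁺ n
  𝕊 d t = fun (old (S d)) (t ∷ [])

  𝕗 : Term VWSig⁺ n → Term VWSig⁺ n
  𝕗 t = fun (old f) (t ∷ [])

  infix 30 _⊑⁺_ _|≤|⁺_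

  _⊑⁺_ : Term VWSig⁺ n → Term VWSig⁺ n → Formula VWSig⁺ n
  t ⊑⁺ u = rel ⊑ (t ∷ u ∷ [])

  _|≤|⁺_ : Term VWSig⁺ n → Term VWSig⁺ n → Formula VWSig⁺ n
  t |≤|⁺ u = rel |≤| (t ∷ u ∷ [])

Context : ℕ → Set
Context n = List (Formula VWSig⁺ n)

infix 4 _⊢_

_⊢_ : ∀ {n} → Context n → Formula VWSig⁺ n → Set
Γ ⊢ φ = VW⁺⁺ ∣ Γ ⊢ φ

subst-⋁ : ∀ {Σ m n} {A : Set} (σ : Fin m → Term Σ n) (g : A → Formula Σ m) xs →
  subst σ (⋁ (map g xs)) ≡ ⋁ (map (subst σ ∘ g) xs)
subst-⋁ σ g []       = refl
subst-⋁ σ g (x ∷ xs) = cong (_ ∨_) (subst-⋁ σ g xs)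

⌜⋁⌝ : ∀ {n} {A : Set} (g : A → Formula VWSig⁺ n) xs → ⌜ ⋁ (map g xs) ⌝ ≡ ⋁ (map (⌜_⌝ ∘ g) xs)
⌜⋁⌝ g []       = refl
⌜⋁⌝ g (x ∷ xs) = cong (_ ∨_) (⌜⋁⌝ g xs)

module _ {n : ℕ} {Γ : Context n} where

  ⋁I : ∀ {A : Set} (g : A → Formula VWSig⁺ n) {x xs} → x ∈ xs → Γ ⊢ g x → Γ ⊢ ⋁ (map g xs)
  ⋁I g (here refl) d = ∨I₁ d
  ⋁I g (there p)   d = ∨I₂ (⋁I g p d)

  ⋁E : ∀ {A : Set} (g : A → Formula VWSig⁺ n) {χ} xs → (∀ {x} → x ∈ xs → Γ ⊢ g x ⇒ χ) →
    Γ ⊢ ⋁ (map g xs) ⇒ χ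
  ⋁E g []       h = ⇒I (⊥E (hyp (here refl)))
  ⋁E g (x ∷ xs) h = ⇒I (∨E (hyp (here refl))
    (⇒E (under-⊢ (under-⊢ (h (here refl)))) (hyp (here refl)))
    (⇒E (under-⊢ (under-⊢ (⋁E g xs (h ∘ there)))) (hyp (here refl))))

  ∨-fold : ∀ {φ ψ χ} → Γ ⊢ φ ∨ ψ → Γ ⊢ φ ⇒ χ → Γ ⊢ ψ ⇒ χ → Γ ⊢ χ
  ∨-fold p d d′ = ∨E p (⇒E (under-⊢ d) (hyp (here refl))) (⇒E (under-⊢ d′) (hyp (here refl)))

  𝕊-cong : ∀ {d t u} → Γ ⊢ t ≐ u → Γ ⊢ 𝕊 d t ≐ 𝕊 d u
  𝕊-cong p = ≐-fun (λ { zero → p }) (old (S _))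

  𝕗-cong : ∀ {t u} → Γ ⊢ t ≐ u → Γ ⊢ 𝕗 t ≐ 𝕗 u
  𝕗-cong p = ≐-fun (λ { zero → p }) (old f)

  ⊑-cong : ∀ {t t′ u u′} → Γ ⊢ t ≐ t′ → Γ ⊢ u ≐ u′ → Γ ⊢ t ⊑⁺ u → Γ ⊢ t′ ⊑⁺ u′
  ⊑-cong p q = ≐-rel (λ { zero → p ; (suc zero) → q }) ⊑

  |≤|-cong : ∀ {t t′ u u′} → Γ ⊢ t ≐ t′ → Γ ⊢ u ≐ u′ → Γ ⊢ t |≤|⁺ u → Γ ⊢ t′ |≤|⁺ u′
  |≤|-cong p q = ≐-rel (λ { zero → p ; (suc zero) → q }) |≤|

  ⟨⟩-cong : ∀ {u v} → u ≡ v → Γ ⊢ ⟨ u ⟩ ≐ ⟨ v ⟩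
  ⟨⟩-cong refl = ≐-refl _

  𝕊-⟨⟩ : ∀ d w → Γ ⊢ 𝕊 d ⟨ w ⟩ ≐ ⟨ w ∷ʳ d ⟩
  𝕊-⟨⟩ d w = ∀-closure-E {n = 0} (𝕊 d ⟨ w ⟩ ≐ ⟨ w ∷ʳ d ⟩) (proper (vw2 w d)) (λ ())

  𝕗-⟨⟩ : ∀ w → Γ ⊢ 𝕗 ⟨ w ⟩ ≐ ⟨ reverse w ⟩
  𝕗-⟨⟩ w = ∀-closure-E {n = 0} (𝕗 ⟨ w ⟩ ≐ ⟨ reverse w ⟩) (proper (vw8 w)) (λ ())

  -- Equality of words is decided outside the theory, and unequal words refute the hypothesis. The
  -- continuation is needed because `Γ` may be inconsistent, so that `u ≡ v` itself does not follow.
  ⟨⟩-injective : ∀ u v {χ} → Γ ⊢ ⟨ u ⟩ ≐ ⟨ v ⟩ → (u ≡ v → Γ ⊢ χ) → Γ ⊢ χ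
  ⟨⟩-injective u v d k with ≡-dec _≟_ u v
  ... | yes eq = k eq
  ... | no neq =
    ⊥E (⇒E (∀-closure-E {n = 0} (¬̇ (⟨ u ⟩ ≐ ⟨ v ⟩)) (proper (vw1 u v neq)) (λ ())) d)

  ⊑-∷ʳ : ∀ d w t → Γ ⊢ t ⊑⁺ 𝕊 d ⟨ w ⟩ ⇔ t ⊑⁺ ⟨ w ⟩ ∨ t ≐ 𝕊 d ⟨ w ⟩
  ⊑-∷ʳ d w t = ∀-closure-E {n = 1}
    (var zero ⊑⁺ 𝕊 d ⟨ w ⟩ ⇔ var zero ⊑⁺ ⟨ w ⟩ ∨ var zero ≐ 𝕊 d ⟨ w ⟩) (proper (vw5 w d)) (λ _ → t)

-- Induction is on the last letter, since the axiom `vw5` describes what lies below a word when a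
-- letter is appended.
⊑-intro : ∀ {n} {Γ : Context n} u r → Γ ⊢ ⟨ u ⟩ ⊑⁺ ⟨ u ++ r ⟩
⊑-intro {Γ = Γ} u r = go (reverseView r)
  where
  ⊑-refl : ∀ {w} → Reverse w → Γ ⊢ ⟨ w ⟩ ⊑⁺ ⟨ w ⟩
  ⊑-refl []            =
    ∀-closure-E {n = 0} (⟨ [] ⟩ ⊑⁺ ⟨ [] ⟩) (proper (vw3 [])) (λ ())
  ⊑-refl (w ∶ _ ∶ʳ d) = ⊑-cong (≐-refl _) (𝕊-⟨⟩ d w)
    (⇒E (∧E₂ (⊑-∷ʳ d w ⟨ w ∷ʳ d ⟩)) (∨I₂ (≐-sym (𝕊-⟨⟩ d w))))

  go : ∀ {r} → Reverse r → Γ ⊢ ⟨ u ⟩ ⊑⁺ ⟨ u ++ r ⟩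
  go []            = ⊑-cong (≐-refl _) (⟨⟩-cong (sym (++-identityʳ u))) (⊑-refl (reverseView u))
  go (r ∶ rs ∶ʳ d) =
    ⊑-cong (≐-refl _) (≐-trans (𝕊-⟨⟩ d (u ++ r)) (⟨⟩-cong (++-assoc u r (d ∷ []))))
      (⇒E (∧E₂ (⊑-∷ʳ d (u ++ r) ⟨ u ⟩)) (∨I₁ (go rs)))

-- Nonstandard elements are excluded below a standard word: `vw4` settles the empty word, and `vw5`
-- adds only the whole word at each further letter.
⊑-elim : ∀ {n} {Γ : Context n} w {t χ} →
  (∀ u r → u ++ r ≡ w → Γ ⊢ t ≐ ⟨ u ⟩ ⇒ χ) → Γ ⊢ t ⊑⁺ ⟨ w ⟩ ⇒ χ
⊑-elim {Γ = Γ} w {t} {χ} = go (reverseView w)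
  where
  go : ∀ {w} → Reverse w → (∀ u r → u ++ r ≡ w → Γ ⊢ t ≐ ⟨ u ⟩ ⇒ χ) → Γ ⊢ t ⊑⁺ ⟨ w ⟩ ⇒ χ
  go [] h = ⇒I (⇒E (under-⊢ (h [] [] refl)) (⇒E
    (∀-closure-E {n = 1} (var zero ⊑⁺ ⟨ [] ⟩ ⇒ var zero ≐ ⟨ [] ⟩) (proper vw4) (λ _ → t))
    (hyp (here refl))))
  go (w ∶ ws ∶ʳ d) h = ⇒I (∨-fold
    (⇒E (∧E₁ (⊑-∷ʳ d w t)) (⊑-cong (≐-refl _) (≐-sym (𝕊-⟨⟩ d w)) (hyp (here refl))))
    (under-⊢ (go ws λ u r eq → h u (r ∷ʳ d)
      (trans (sym (++-assoc u r (d ∷ []))) (cong (_∷ʳ d) eq))))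
    (⇒I (⇒E (under-⊢ (under-⊢ (h (w ∷ʳ d) [] (++-identityʳ _))))
      (≐-trans (hyp (here refl)) (𝕊-⟨⟩ d w)))))

module _ {n : ℕ} {Γ : Context n} where

  ⊑-inversion : ∀ u w {χ} → Γ ⊢ ⟨ u ⟩ ⊑⁺ ⟨ w ⟩ → (∀ r → u ++ r ≡ w → Γ ⊢ χ) → Γ ⊢ χ
  ⊑-inversion u w d k = ⇒E (⊑-elim w λ v r eq → ⇒I (⟨⟩-injective u v (hyp (here refl))
    λ { refl → under-⊢ (k r eq) })) d

  -- The disjunction runs over a list depending on `m`, so neither expansion nor substitution
  -- computes on it; both are pushed through by induction on the list.
  |≤|-axiom : ∀ m t →
    Γ ⊢ t |≤|⁺ ⟨ twos m ⟩ ⇔ ⋁ (map (λ s → t ≐ ⟨ s ⟩) (wordsUpTo m))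
  |≤|-axiom m t = cast (cong (λ ψ → t |≤|⁺ ⟨ twos m ⟩ ⇔ ψ) (subst-⋁ (λ _ → t) g (wordsUpTo m)))
    (∀-closure-E {n = 1} (var zero |≤|⁺ ⟨ twos m ⟩ ⇔ ⋁ (map g (wordsUpTo m)))
      (proper (≡.subst (λ ψ → VW⁺ (∀̇ (var zero |≤̇| canonical (twos m) ⇔ ψ)))
        (sym (⌜⋁⌝ g (wordsUpTo m))) (vw6 m)))
      (λ _ → t))
    where
    g : Word → Formula VWSig⁺ 1
    g s = var zero ≐ ⟨ s ⟩

module _ {n : ℕ} {Γ : Context n} where

  |≤|-intro : ∀ u m → length u ≤ m → Γ ⊢ ⟨ u ⟩ |≤|⁺ ⟨ twos m ⟩
  |≤|-intro u m h = ⇒E (∧E₂ (|≤|-axiom m ⟨ u ⟩))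
    (⋁I (λ s → ⟨ u ⟩ ≐ ⟨ s ⟩) (∈-wordsUpTo⁺ m h) (≐-refl _))

  |≤|-elim : ∀ m {t χ} → (∀ u → length u ≤ m → Γ ⊢ t ≐ ⟨ u ⟩ ⇒ χ) → Γ ⊢ t |≤|⁺ ⟨ twos m ⟩ ⇒ χ
  |≤|-elim m {t} h = ⇒I (⇒E
    (under-⊢ (⋁E (λ s → t ≐ ⟨ s ⟩) (wordsUpTo m) λ {u} p → h u (∈-wordsUpTo⁻ m p)))
    (⇒E (∧E₁ (|≤|-axiom m t)) (hyp (here refl))))

module _ {n : ℕ} {Γ : Context n} where

  |≤|-inversion : ∀ u m {χ} → Γ ⊢ ⟨ u ⟩ |≤|⁺ ⟨ twos m ⟩ → (length u ≤ m → Γ ⊢ χ) → Γ ⊢ χ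
  |≤|-inversion u m d k = ⇒E (|≤|-elim m λ v h → ⇒I (⟨⟩-injective u v (hyp (here refl))
    λ { refl → under-⊢ (k h) })) d

  -- By `⊑-elim` a quantifier bounded by a standard word amounts to finitely many instances at its
  -- initial segments.
  bounded-∀I : ∀ w χ → (∀ u r → u ++ r ≡ w → Γ ⊢ χ [ ⟨ u ⟩ ]) → Γ ⊢ ∀̇ (var zero ⊑⁺ ⟨ w ⟩ ⇒ χ)
  bounded-∀I w χ h = ∀I (⊑-elim w λ u r eq → ⇒I
    (cast (rename-lift-[var] χ) (replace (rename (liftᵣ suc) χ) (≐-sym (hyp (here refl)))
      (cast (rename-[] suc χ ⟨ u ⟩) (under-⊢ (weaken-⊢ (h u r eq)))))))

-- Minimal chains

infix 35 ↑_

↑_ : ∀ {n} → Term VWSig⁺ n → Term VWSig⁺ (suc n)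
↑_ = renameₜ suc

-- φ says of z, and ψ of variable zero, that the property sought holds.
Chain : ∀ {n} → Term VWSig⁺ n → Term VWSig⁺ n → Formula VWSig⁺ n → Formula VWSig⁺ (suc n) →
        Formula VWSig⁺ n
Chain a z φ ψ = a ⊑⁺ z ∧ φ ∧
  ∀̇ (var zero ⊑⁺ ↑ z ⇒ ↑ a ⊑⁺ var zero ⇒
     var zero ≐ ↑ z ∨ (𝕊 𝟐 (var zero) ⊑⁺ ↑ z ∧ ¬̇ ψ))

inst-↑ : ∀ {n} (u t : Term VWSig⁺ n) → substₜ (instₛ u) (↑ t) ≡ t
inst-↑ u t = trans (substₜ-renameₜ (λ _ → refl) t) (substₜ-var (λ _ → refl) t)

-- An instance of the quantified clause of `Chain`. That `𝕊 𝟐 u` is again below `z` lets one climb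
-- from `u` to the next member of the chain.
Step : ∀ {n} (a z u : Term VWSig⁺ n) → Formula VWSig⁺ n → Formula VWSig⁺ n
Step a z u ψ = u ⊑⁺ z ⇒ a ⊑⁺ u ⇒ u ≐ z ∨ (𝕊 𝟐 u ⊑⁺ z ∧ ¬̇ ψ)

chain-step : ∀ {n} {Γ : Context n} a z {φ ψ} → Γ ⊢ Chain a z φ ψ → ∀ u → Γ ⊢ Step a z u (ψ [ u ])
chain-step a z {ψ = ψ} d u =
  cast (cong₂ (λ a z → Step a z u (ψ [ u ])) (inst-↑ u a) (inst-↑ u z)) (∀E (∧E₂ (∧E₂ d)) u)

module _ {n : ℕ} {Γ : Context n} {a : Term VWSig⁺ n} (w : Word) (a≐w : Γ ⊢ a ≐ ⟨ w ⟩)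
         (k : ℕ) (D : Term VWSig⁺ n → Formula VWSig⁺ n)
         (below : ∀ j → j < k → Γ ⊢ ¬̇ D ⟨ w ++ twos j ⟩) where

  private
    a⊑_ : ∀ j → Γ ⊢ a ⊑⁺ ⟨ w ++ twos j ⟩
    a⊑ j = ⊑-cong (≐-sym a≐w) (≐-refl _) (⊑-intro w (twos j))

    next : ∀ j → Γ ⊢ 𝕊 𝟐 ⟨ w ++ twos j ⟩ ≐ ⟨ w ++ twos (suc j) ⟩
    next j = ≐-trans (𝕊-⟨⟩ 𝟐 _)
      (⟨⟩-cong (trans (++-assoc w (twos j) (𝟐 ∷ [])) (cong (w ++_) (twos-∷ʳ j))))

  -- Climb from `w` by appending 2's, staying below the possibly nonstandard `z`. Before stage `k`
  -- the word is not `z`, since `D` holds of `z` but fails there, so the next word is below `z` too.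
  -- At stage `k` the alternative of going on contradicts `Dk`, which leaves equality.
  chain-unique : ∀ {z} → Γ ⊢ a ⊑⁺ z → Γ ⊢ D z → (∀ u → Γ ⊢ Step a z ⟨ u ⟩ (D ⟨ u ⟩)) →
    (∀ {u} → Γ ⊢ u ≐ z ⇒ D u) → Γ ⊢ D ⟨ w ++ twos k ⟩ → Γ ⊢ z ≐ ⟨ w ++ twos k ⟩
  chain-unique {z} a⊑z Dz step D-resp Dk =
    ⇒E (climb 0 k refl) (⊑-cong (≐-trans a≐w (⟨⟩-cong (sym (++-identityʳ w)))) (≐-refl _) a⊑z)
    where
    -- The recursion is on the number `i` of stages left, a standard number, so no induction inside
    -- the theory is needed.
    climb : ∀ j i → j + i ≡ k → Γ ⊢ ⟨ w ++ twos j ⟩ ⊑⁺ z ⇒ z ≐ ⟨ w ++ twos k ⟩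
    climb j i eq = ⇒I (∨-fold
      (⇒E (⇒E (under-⊢ (step (w ++ twos j))) (hyp (here refl))) (under-⊢ (a⊑ j)))
      (under-⊢ (reached i eq)) (under-⊢ (continued i eq)))
      where
      reached : ∀ i → j + i ≡ k → Γ ⊢ ⟨ w ++ twos j ⟩ ≐ z ⇒ z ≐ ⟨ w ++ twos k ⟩
      reached zero    eq = ⇒I (≐-trans (≐-sym (hyp (here refl)))
        (⟨⟩-cong (cong (λ i → w ++ twos i) (trans (sym (+-identityʳ j)) eq))))
      reached (suc i) eq = ⇒I (⊥E (⇒E
        (under-⊢ (below j (≡.subst (j <_) eq (m<m+n j (s≤s z≤n)))))
        (⇒E (under-⊢ D-resp) (hyp (here refl)))))

      continued : ∀ i → j + i ≡ k →
        Γ ⊢ 𝕊 𝟐 ⟨ w ++ twos j ⟩ ⊑⁺ z ∧ ¬̇ D ⟨ w ++ twos j ⟩ ⇒ z ≐ ⟨ w ++ twos k ⟩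
      continued zero eq with refl ← trans (sym (+-identityʳ j)) eq =
        ⇒I (⊥E (⇒E (∧E₂ (hyp (here refl))) (under-⊢ Dk)))
      continued (suc i) eq = ⇒I (⇒E
        (under-⊢ (climb (suc j) i (trans (sym (+-suc j i)) eq)))
        (⊑-cong (under-⊢ (next j)) (≐-refl _) (∧E₁ (hyp (here refl)))))

  -- This checks the quantified clause of `Chain` at one initial segment of the solution. By
  -- `prefix-twos` it is the solution itself, or an earlier member of the chain where `below`
  -- applies, or too short to lie above `a`.
  chain-exists : ∀ u r → u ++ r ≡ w ++ twos k →
    Γ ⊢ a ⊑⁺ ⟨ u ⟩ ⇒ ⟨ u ⟩ ≐ ⟨ w ++ twos k ⟩ ∨ (𝕊 𝟐 ⟨ u ⟩ ⊑⁺ ⟨ w ++ twos k ⟩ ∧ ¬̇ D ⟨ u ⟩)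
  chain-exists u r eq with prefix-twos w u r k eq
  ... | inj₁ (j , zero , refl , refl) =
    ⇒I (∨I₁ (⟨⟩-cong (cong (λ i → w ++ twos i) (sym (+-identityʳ j)))))
  ... | inj₁ (j , suc i , refl , refl) = ⇒I (under-⊢ (∨I₂ (∧I
    (⊑-cong (≐-sym (next j))
      (⟨⟩-cong (trans (++-assoc w (twos (suc j)) (twos i))
        (cong (w ++_) (trans (twos-+ (suc j) i) (cong twos (sym (+-suc j i)))))))
      (⊑-intro (w ++ twos (suc j)) (twos i)))
    (below j (m<m+n j (s≤s z≤n))))))
  ... | inj₂ h = ⇒I (⊑-inversion w u
    (⊑-cong (under-⊢ a≐w) (≐-refl _) (hyp (here refl)))
    λ x eq → contradiction eq (h x))

-- Lengths

-- The chain of tallies starts at the empty word, and for a standard `p` the first one bounding it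
-- is its length in unary.
Length : ∀ {n} → Term VWSig⁺ n → Term VWSig⁺ n → Formula VWSig⁺ n
Length p z = Chain ⟨ [] ⟩ z (p |≤|⁺ z) (↑ p |≤|⁺ var zero)

module _ {n : ℕ} {Γ : Context n} {p : Term VWSig⁺ n} (w : Word) (p≐w : Γ ⊢ p ≐ ⟨ w ⟩) where

  length-below : ∀ j → j < length w → Γ ⊢ ¬̇ (p |≤|⁺ ⟨ twos j ⟩)
  length-below j h = ⇒I (|≤|-inversion w j (|≤|-cong (under-⊢ p≐w) (≐-refl _) (hyp (here refl)))
    λ h′ → contradiction h′ (<⇒≱ h))

  length-at : Γ ⊢ p |≤|⁺ ⟨ twos (length w) ⟩
  length-at = |≤|-cong (≐-sym p≐w) (≐-refl _) (|≤|-intro w (length w) (≤-reflexive refl))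

  -- The measured term need only be provably equal to a word, because it will later be `𝕊 𝟏 z` with
  -- a variable `z`.
  length-unique : ∀ {z} → Γ ⊢ Length p z → Γ ⊢ z ≐ ⟨ twos (length w) ⟩
  length-unique {z} d = chain-unique [] (≐-refl _) (length w) (p |≤|⁺_) length-below
    (∧E₁ d) (∧E₁ (∧E₂ d))
    (λ u → cast (cong (λ p → Step ⟨ [] ⟩ z ⟨ u ⟩ (p |≤|⁺ ⟨ u ⟩)) (inst-↑ ⟨ u ⟩ p))
      (chain-step ⟨ [] ⟩ z d ⟨ u ⟩))
    (⇒I (|≤|-cong (≐-refl _) (≐-sym (hyp (here refl))) (under-⊢ (∧E₁ (∧E₂ d)))))
    length-at

  length-exists : Γ ⊢ Length p ⟨ twos (length w) ⟩
  length-exists = ∧I (⊑-intro [] (twos (length w))) (∧I length-at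
    (bounded-∀I (twos (length w)) _ λ u r eq →
      cast (cong (λ p → ⟨ [] ⟩ ⊑⁺ ⟨ u ⟩ ⇒ ⟨ u ⟩ ≐ ⟨ twos (length w) ⟩ ∨
             (𝕊 𝟐 ⟨ u ⟩ ⊑⁺ ⟨ twos (length w) ⟩ ∧ ¬̇ (p |≤|⁺ ⟨ u ⟩))) (sym (inst-↑ ⟨ u ⟩ p)))
        (chain-exists [] (≐-refl _) (length w) (p |≤|⁺_) length-below u r eq)))

-- Padding by a tally

-- z is s12ᵏ, where T is 2ᵏ: reversing z puts its tail of 2's in front of the
-- separating 1, where ⊑ can compare it with T.
Padded : ∀ {n} → Term VWSig⁺ n → Term VWSig⁺ n → Term VWSig⁺ n → Formula VWSig⁺ n
Padded s T z = Chain (𝕊 𝟏 s) z (𝕊 𝟏 T ⊑⁺ 𝕗 z) (𝕊 𝟏 (↑ T) ⊑⁺ 𝕗 (var zero))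

padded : Word → ℕ → Word
padded s k = (s ∷ʳ 𝟏) ++ twos k

reverse-padded : ∀ s j → reverse (padded s j) ≡ twos j ++ 𝟏 ∷ reverse s
reverse-padded s j = trans (reverse-++ (s ∷ʳ 𝟏) (twos j))
  (cong₂ _++_ (reverse-twos j) (reverse-++ s (𝟏 ∷ [])))

length-padded : ∀ s k → length (padded s k) ≡ suc (length s + k)
length-padded s k = trans (length-++ (s ∷ʳ 𝟏))
  (trans (cong₂ _+_ (length-++ s) (length-replicate k))
  (trans (cong (_+ k) (+-comm (length s) 1)) refl))

module _ {n : ℕ} {Γ : Context n} (s : Word) (k : ℕ) where

  private
    D : Term VWSig⁺ n → Formula VWSig⁺ n
    D z = 𝕊 𝟏 ⟨ twos k ⟩ ⊑⁺ 𝕗 z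

  -- Otherwise the reversal of `padded s j` would begin with `k` 2's and a 1, whereas its first 1
  -- comes after `j` of them.
  padded-below : ∀ j → j < k → Γ ⊢ ¬̇ D ⟨ padded s j ⟩
  padded-below j h = ⇒I (⊑-inversion (twos k ∷ʳ 𝟏) (twos j ++ 𝟏 ∷ reverse s)
    (⊑-cong (𝕊-⟨⟩ 𝟏 _) (≐-trans (𝕗-⟨⟩ _) (⟨⟩-cong (reverse-padded s j))) (hyp (here refl)))
    λ r eq → contradiction
      (≤-reflexive (twos-𝟏-injective k j (trans (sym (++-assoc (twos k) (𝟏 ∷ []) r)) eq)))
      (<⇒≱ h))

  padded-at : Γ ⊢ D ⟨ padded s k ⟩
  padded-at = ⊑-cong (≐-sym (𝕊-⟨⟩ 𝟏 _))
    (≐-sym (≐-trans (𝕗-⟨⟩ _) (⟨⟩-cong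
      (trans (reverse-padded s k) (sym (++-assoc (twos k) (𝟏 ∷ []) (reverse s)))))))
    (⊑-intro (twos k ∷ʳ 𝟏) (reverse s))

  padded-unique : ∀ {z} → Γ ⊢ Padded ⟨ s ⟩ ⟨ twos k ⟩ z → Γ ⊢ z ≐ ⟨ padded s k ⟩
  padded-unique {z} d = chain-unique (s ∷ʳ 𝟏) (𝕊-⟨⟩ 𝟏 s) k D padded-below
    (∧E₁ d) (∧E₁ (∧E₂ d))
    (λ u → chain-step (𝕊 𝟏 ⟨ s ⟩) z d ⟨ u ⟩)
    (⇒I (⊑-cong (≐-refl _) (𝕗-cong (≐-sym (hyp (here refl)))) (under-⊢ (∧E₁ (∧E₂ d)))))
    padded-at

  padded-exists : Γ ⊢ Padded ⟨ s ⟩ ⟨ twos k ⟩ ⟨ padded s k ⟩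
  padded-exists = ∧I
    (⊑-cong (≐-sym (𝕊-⟨⟩ 𝟏 s)) (≐-refl _) (⊑-intro (s ∷ʳ 𝟏) (twos k)))
    (∧I padded-at (bounded-∀I (padded s k) _
      (chain-exists (s ∷ʳ 𝟏) (𝕊-⟨⟩ 𝟏 s) k D padded-below)))

-- Concatenation

-- The bound makes `z` standard, so that the other clauses can be evaluated; the reversals say that
-- `y` is a final segment. As `b` also counts the separating 1, it is the length of `z` with one
-- letter appended.
Concat′ : ∀ {n} (x y z b : Term VWSig⁺ n) → Formula VWSig⁺ n
Concat′ x y z b = z |≤|⁺ b ∧ x ⊑⁺ z ∧ 𝕗 y ⊑⁺ 𝕗 z ∧ Length (𝕊 𝟏 z) b

-- b is 2 to the power |x| + 1 + |y|, found as the length of x12^|y|.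
Concat : ∀ {n} → Term VWSig⁺ n → Term VWSig⁺ n → Term VWSig⁺ n → Formula VWSig⁺ n
Concat x y z =
  ∃̇ (Length (↑ y) (var zero) ∧
  ∃̇ (Padded (↑ ↑ x) (var (suc zero)) (var zero) ∧
  ∃̇ (Length (var (suc zero)) (var zero) ∧
     Concat′ (↑ ↑ ↑ x) (↑ ↑ ↑ y) (↑ ↑ ↑ z) (var zero))))

module _ {n : ℕ} {Γ : Context n} (s t : Word) where

  private
    m : ℕ
    m = length (padded s (length t))

  -- Each of the three intermediate values is uniquely determined once the previous one is known to
  -- be standard, so they are replaced by words from the outside in.
  concat-bound : ∀ i → Γ ⊢ Concat ⟨ s ⟩ ⟨ t ⟩ (var i) →
    Γ ⊢ Concat′ ⟨ s ⟩ ⟨ t ⟩ (var i) ⟨ twos m ⟩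
  concat-bound i d =
    ∃-unique _ (Concat′ ⟨ s ⟩ ⟨ t ⟩ (var (suc i)) (var zero))
    (∃-unique _ (∃̇ (Length (var (suc zero)) (var zero) ∧
        Concat′ ⟨ s ⟩ ⟨ t ⟩ (var (suc (suc i))) (var zero)))
    (∃-unique _ (∃̇ (Padded ⟨ s ⟩ (var (suc zero)) (var zero) ∧
      ∃̇ (Length (var (suc zero)) (var zero) ∧
        Concat′ ⟨ s ⟩ ⟨ t ⟩ (var (suc (suc (suc i)))) (var zero)))) d
      (length-unique t (≐-refl _) (hyp (here refl))))
      (padded-unique s (length t) (hyp (here refl))))
      (length-unique (padded s (length t)) (≐-refl _) (hyp (here refl)))

  concat′-unique : ∀ {z} → Γ ⊢ Concat′ ⟨ s ⟩ ⟨ t ⟩ z ⟨ twos m ⟩ ⇒ z ≐ ⟨ s ++ t ⟩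
  -- The first conjunct makes `z` one of finitely many standard words `w`.
  concat′-unique {z} = ⇒I (⇒E (|≤|-elim m λ w _ → ⇒I (identify w (hyp (here refl)) (hyp (there (here refl)))))
    (∧E₁ (hyp (here refl))))
    where
    identify : ∀ {Δ} w → Δ ⊢ z ≐ ⟨ w ⟩ → Δ ⊢ Concat′ ⟨ s ⟩ ⟨ t ⟩ z ⟨ twos m ⟩ → Δ ⊢ z ≐ ⟨ s ++ t ⟩
    identify w z≐w d =
      ⊑-inversion s w (⊑-cong (≐-refl _) z≐w (∧E₁ (∧E₂ d))) λ r p →
      ⊑-inversion (reverse t) (reverse w)
        (⊑-cong (𝕗-⟨⟩ t) (≐-trans (𝕗-cong z≐w) (𝕗-⟨⟩ w)) (∧E₁ (∧E₂ (∧E₂ d)))) λ r′ q →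
      -- The bound is also the length of `w` followed by 1; cancelling one on both sides gives the
      -- length condition of `prefix-suffix`.
      ⟨⟩-injective (twos m) (twos (length (w ∷ʳ 𝟏)))
        (length-unique (w ∷ʳ 𝟏) (≐-trans (𝕊-cong z≐w) (𝕊-⟨⟩ 𝟏 w)) (∧E₂ (∧E₂ (∧E₂ d)))) λ h →
      ≐-trans z≐w (⟨⟩-cong (prefix-suffix s t r p q (suc-injective
        (trans (trans (+-comm 1 (length w)) (sym (length-++ w)))
          (trans (sym (twos-injective h)) (length-padded s (length t)))))))

concat-unique : ∀ {n} {Γ : Context n} s t i → Γ ⊢ Concat ⟨ s ⟩ ⟨ t ⟩ (var i) ⇒ var i ≐ ⟨ s ++ t ⟩
concat-unique s t i = ⇒I (⇒E (concat′-unique s t) (concat-bound s t i (hyp (here refl))))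

module _ {n : ℕ} {Γ : Context n} (s t : Word) where

  concat-exists : Γ ⊢ Concat ⟨ s ⟩ ⟨ t ⟩ ⟨ s ++ t ⟩
  concat-exists =
    ∃I ⟨ twos (length t) ⟩ (∧I (length-exists t (≐-refl _))
    (∃I ⟨ padded s (length t) ⟩ (∧I (padded-exists s (length t))
    (∃I ⟨ twos m ⟩ (∧I (length-exists (padded s (length t)) (≐-refl _))
      (∧I (|≤|-intro (s ++ t) m (≡.subst (length (s ++ t) ≤_) (sym m≡) (n≤1+n _)))
      (∧I (⊑-intro s t)
      (∧I (⊑-cong (≐-sym (𝕗-⟨⟩ t))
            (≐-sym (≐-trans (𝕗-⟨⟩ _) (⟨⟩-cong (reverse-++ s t)))) (⊑-intro (reverse t) (reverse s)))
        -- The letter appended to the concatenation accounts for the separator counted in `m`.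
        (≡.subst (λ k → Γ ⊢ Length (𝕊 𝟏 ⟨ s ++ t ⟩) ⟨ twos k ⟩)
          (trans (length-++ (s ++ t)) (trans (+-comm (length (s ++ t)) 1) (sym m≡)))
          (length-exists ((s ++ t) ∷ʳ 𝟏) (𝕊-⟨⟩ 𝟏 _))))))))))) 
    where
    m : ℕ
    m = length (padded s (length t))

    m≡ : m ≡ suc (length (s ++ t))
    m≡ = trans (length-padded s (length t)) (cong suc (sym (length-++ s)))

-- Making concatenation total and single-valued

UniqueConcat : ∀ {n} → Term VWSig⁺ n → Term VWSig⁺ n → Term VWSig⁺ n → Formula VWSig⁺ n
UniqueConcat x y z = Concat x y z ∧ ∀̇ (Concat (↑ x) (↑ y) (var zero) ⇒ var zero ≐ ↑ z)

TotalConcat : ∀ {n} → Term VWSig⁺ n → Term VWSig⁺ n → Term VWSig⁺ n → Formula VWSig⁺ n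
TotalConcat x y z = UniqueConcat x y z ∨
  (¬̇ ∃̇ (UniqueConcat (↑ x) (↑ y) (var zero)) ∧ z ≐ ⟨ [] ⟩)

total-concat-exists : ∀ {n} {Γ : Context n} i j →
  Γ ⊢ ∃̇ (TotalConcat (var (suc i)) (var (suc j)) (var zero))
total-concat-exists i j = ∨E (excluded-middle (∃̇ (UniqueConcat (var (suc i)) (var (suc j)) (var zero))))
  (∃E (hyp (here refl)) (∃I (var zero) (∨I₁ (hyp (here refl)))))
  (∃I ⟨ [] ⟩ (∨I₂ (∧I (hyp (here refl)) (≐-refl _))))

-- Two proper values agree by the uniqueness clause of one of them, two default values are both
-- empty, and the mixed cases are contradictory.
total-concat-unique : ∀ {n} {Γ : Context n} i j k l →
  Γ ⊢ TotalConcat (var i) (var j) (var k) ∧ TotalConcat (var i) (var j) (var l) ⇒ var k ≐ var l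
total-concat-unique i j k l = ⇒I (∨E (∧E₁ (hyp (here refl)))
  (∨E (∧E₂ (hyp (there (here refl))))
    (≐-sym (⇒E (∀E (∧E₂ (hyp (there (here refl)))) (var l)) (∧E₁ (hyp (here refl)))))
    (⊥E (⇒E (∧E₁ (hyp (here refl))) (∃I (var k) (hyp (there (here refl)))))))
  (∨E (∧E₂ (hyp (there (here refl))))
    (⊥E (⇒E (∧E₁ (hyp (there (here refl)))) (∃I (var l) (hyp (here refl)))))
    (≐-trans (∧E₂ (hyp (there (here refl)))) (≐-sym (∧E₂ (hyp (here refl)))))))

total-concat-⟨⟩ : ∀ {n} {Γ : Context n} s t → Γ ⊢ TotalConcat ⟨ s ⟩ ⟨ t ⟩ ⟨ s ++ t ⟩
total-concat-⟨⟩ s t = ∨I₁ (∧I (concat-exists s t) (∀I (concat-unique s t zero)))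

-- The translation

digit : Bool → Digit
digit false = 𝟏
digit true  = 𝟐

digit-injective : ∀ {b c} → digit b ≡ digit c → b ≡ c
digit-injective {false} {false} _ = refl
digit-injective {true}  {true}  _ = refl

encode : BinaryString → Word
encode s = map digit (toList s)

encode-injective : ∀ {s t} → encode s ≡ encode t → s ≡ t
encode-injective {a ∷ s} {b ∷ t} eq with map-injective digit-injective eq
... | refl = refl

encode-⁺++⁺ : ∀ s t → encode (s ⁺++⁺ t) ≡ encode s ++ encode t
encode-⁺++⁺ (a ∷ s) (b ∷ t) = map-++ digit (a ∷ s) (b ∷ t)

∈-inits⁺ : ∀ {u r} xs → u ++ r ≡ map digit xs → ∃[ ys ] ys ∈ inits xs × map digit ys ≡ u
∈-inits⁺ {[]}    xs       eq = [] , here refl , refl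
∈-inits⁺ {d ∷ u} (x ∷ xs) eq with ∈-inits⁺ xs (∷-injectiveʳ eq)
... | ys , p , q = x ∷ ys , there (∈-map⁺ (x ∷_) p) , cong₂ _∷_ (sym (∷-injectiveˡ eq)) q

∈-inits⁻ : ∀ {ys} xs → ys ∈ inits xs → ∃[ r ] map digit ys ++ r ≡ map digit xs
∈-inits⁻ xs       (here refl) = map digit xs , refl
∈-inits⁻ (x ∷ xs) (there p) with ∈-map⁻ (x ∷_) p
... | ys , q , refl with ∈-inits⁻ xs q
...   | r , eq = r , cong (digit x ∷_) eq

∈-initialSegments⁺ : ∀ {u r} t → u ++ r ≡ encode t → u ≢ [] →
  ∃[ s ] s ∈ initialSegments t × encode s ≡ u
∈-initialSegments⁺ {[]}    t        eq u≢[] = contradiction refl u≢[]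
∈-initialSegments⁺ {d ∷ u} (b ∷ bs) eq u≢[] with ∈-inits⁺ bs (∷-injectiveʳ eq)
... | ys , p , q = b ∷ ys , ∈-map⁺ (b ∷_) p , cong₂ _∷_ (sym (∷-injectiveˡ eq)) q

∈-initialSegments⁻ : ∀ {s} t → s ∈ initialSegments t → ∃[ r ] encode s ++ r ≡ encode t
∈-initialSegments⁻ (b ∷ bs) p with ∈-map⁻ (b ∷_) p
... | ys , q , refl with ∈-inits⁻ bs q
...   | r , eq = r , cong (digit b ∷_) eq

translation⁺ : Translation WDSig VWSig⁺
translation⁺ = record
  { domain   = ⊥̇ ⇒ ⊥̇
  ; identity = var zero ≐ var (suc zero)
  ; graph    = λ { (const s) → var zero ≐ ⟨ encode s ⟩ }
  ; relation = λ
      -- The empty word lies below every word but encodes no string, so it must be excluded for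
      -- axiom `wd3`.
      { ≼ → var zero ⊑⁺ var (suc zero) ∧ ¬̇ (var zero ≐ ⟨ [] ⟩)
      ; C → TotalConcat (var zero) (var (suc zero)) (var (suc (suc zero))) }
  }

-- Expanding the named words in a translation

⌜_⌝ᵀ : ∀ {Σ} → Translation Σ VWSig⁺ → Translation Σ VWSig
⌜ τ ⌝ᵀ = record
  { domain   = ⌜ τ.domain ⌝
  ; identity = ⌜ τ.identity ⌝
  ; graph    = λ F → ⌜ τ.graph F ⌝
  ; relation = λ R → ⌜ τ.relation R ⌝
  }
  where module τ = Translation τ

module _ {Σ : Signature} (τ : Translation Σ VWSig⁺) where

  private
    module τ⁺ = Translation τ
    module τ⁻ = Translation ⌜ τ ⌝ᵀ

  mutual
    -- Evaluation passes its result to a continuation under new quantifiers, so the two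
    -- continuations are compared at every scope.
    ⌜evalₜ⌝ : ∀ {n m} (t : Term Σ n) (ρ : Fin n → Fin m)
      {κ : ∀ {l} → (Fin m → Fin l) → Fin l → Formula VWSig⁺ l}
      {κ⁻ : ∀ {l} → (Fin m → Fin l) → Fin l → Formula VWSig l} →
      (∀ {l} (ρ : Fin m → Fin l) v → ⌜ κ ρ v ⌝ ≡ κ⁻ ρ v) →
      ⌜ τ⁺.evalₜ t ρ κ ⌝ ≡ τ⁻.evalₜ t ρ κ⁻
    ⌜evalₜ⌝ (var i)    ρ h = h id (ρ i)
    ⌜evalₜ⌝ (fun F ts) ρ h = ⌜evalₜₛ⌝ ts ρ λ ρ′ vs →
      cong ∃̇ (cong₂ _∧_ (⌜rename⌝ _ τ⁺.domain)
        (cong₂ _∧_ (⌜rename⌝ _ (τ⁺.graph F)) (h (suc ∘ ρ′) zero)))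

    ⌜evalₜₛ⌝ : ∀ {n m j} (ts : Vec (Term Σ n) j) (ρ : Fin n → Fin m)
      {κ : ∀ {l} → (Fin m → Fin l) → Vec (Fin l) j → Formula VWSig⁺ l}
      {κ⁻ : ∀ {l} → (Fin m → Fin l) → Vec (Fin l) j → Formula VWSig l} →
      (∀ {l} (ρ : Fin m → Fin l) vs → ⌜ κ ρ vs ⌝ ≡ κ⁻ ρ vs) →
      ⌜ τ⁺.evalₜₛ ts ρ κ ⌝ ≡ τ⁻.evalₜₛ ts ρ κ⁻
    ⌜evalₜₛ⌝ []       ρ h = h id []
    ⌜evalₜₛ⌝ (t ∷ ts) ρ h = ⌜evalₜ⌝ t ρ λ ρ₁ v →
      ⌜evalₜₛ⌝ ts (ρ₁ ∘ ρ) λ ρ₂ vs → h (ρ₂ ∘ ρ₁) (ρ₂ v ∷ vs)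

  ⌜translate⌝ : ∀ {n} (φ : Formula Σ n) → ⌜ τ⁺.translate φ ⌝ ≡ τ⁻.translate φ
  ⌜translate⌝ (rel R ts) = ⌜evalₜₛ⌝ ts id λ _ _ → ⌜rename⌝ _ (τ⁺.relation R)
  ⌜translate⌝ (t ≐ u)    = ⌜evalₜₛ⌝ (t ∷ u ∷ []) id λ _ vs → ⌜rename⌝ (Vec.lookup vs) τ⁺.identity
  ⌜translate⌝ ⊥̇          = refl
  ⌜translate⌝ (φ ⇒ ψ)    = cong₂ _⇒_ (⌜translate⌝ φ) (⌜translate⌝ ψ)
  ⌜translate⌝ (φ ∧ ψ)    = cong₂ _∧_ (⌜translate⌝ φ) (⌜translate⌝ ψ)
  ⌜translate⌝ (φ ∨ ψ)    = cong₂ _∨_ (⌜translate⌝ φ) (⌜translate⌝ ψ)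
  ⌜translate⌝ (∀̇ φ)      = cong ∀̇ (cong₂ _⇒_ (⌜rename⌝ _ τ⁺.domain) (⌜translate⌝ φ))
  ⌜translate⌝ (∃̇ φ)      = cong ∃̇ (cong₂ _∧_ (⌜rename⌝ _ τ⁺.domain) (⌜translate⌝ φ))

-- The translated axioms

open Translation translation⁺ using (translate; relation)

in-domain : ∀ {n} {Γ : Context n} → Γ ⊢ ⊥̇ ⇒ ⊥̇
in-domain = ⇒I (hyp (here refl))

∀ᵈI : ∀ {n} {Γ : Context n} {φ} → map weaken Γ ⊢ φ → Γ ⊢ ∀̇ ((⊥̇ ⇒ ⊥̇) ⇒ φ)
∀ᵈI d = ∀I (⇒I (under-⊢ d))

translate-⋁ : ∀ {n} {A : Set} (g : A → Formula WDSig n) xs →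
  translate (⋁ (map g xs)) ≡ ⋁ (map (translate ∘ g) xs)
translate-⋁ g []       = refl
translate-⋁ g (x ∷ xs) = cong (_ ∨_) (translate-⋁ g xs)

-- Identity is translated by identity, so the translated congruence axioms are instances of
-- `leibniz`, with renamings read as substitutions.
relation-cong : ∀ {m n} {Γ : Context n} (R : WDRel m) (vs ws : Vec (Fin n) m) →
  (∀ i → Γ ⊢ var (Vec.lookup vs i) ≐ var (Vec.lookup ws i)) →
  Γ ⊢ rename (Vec.lookup vs) (relation R) ⇒ rename (Vec.lookup ws) (relation R)
relation-cong R vs ws d = ⇒I (cast (sym (rename≡subst (λ _ → refl) (relation R)))
  (leibniz (under-⊢ ∘ d) (relation R)
    (cast (rename≡subst (λ _ → refl) (relation R)) (hyp (here refl)))))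

identity-axioms : ∀ {φ} → Identity WDSig φ → [] ⊢ translate φ
identity-axioms reflexive  = ∀ᵈI (≐-refl _)
identity-axioms symmetric  = ∀ᵈI (∀ᵈI (⇒I (≐-sym (hyp (here refl)))))
identity-axioms transitive =
  ∀ᵈI (∀ᵈI (∀ᵈI (⇒I (⇒I (≐-trans (hyp (there (here refl))) (hyp (here refl)))))))
identity-axioms (fun-cong (const s)) =
  ⇒I (∃I ⟨ encode s ⟩ (∧I in-domain (∧I (≐-refl _)
     (∃I ⟨ encode s ⟩ (∧I in-domain (∧I (≐-refl _) (≐-refl _)))))))
identity-axioms (rel-cong ≼) = ∀ᵈI (∀ᵈI (∀ᵈI (∀ᵈI (⇒I (relation-cong ≼ (# 0 ∷ # 1 ∷ []) (# 2 ∷ # 3 ∷ [])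
  λ { zero       → ∧E₁ (hyp (here refl))
    ; (suc zero) → ∧E₁ (∧E₂ (hyp (here refl))) })))))
identity-axioms (rel-cong C) = ∀ᵈI (∀ᵈI (∀ᵈI (∀ᵈI (∀ᵈI (∀ᵈI (⇒I (relation-cong C
  (# 0 ∷ # 1 ∷ # 2 ∷ []) (# 3 ∷ # 4 ∷ # 5 ∷ [])
  λ { zero             → ∧E₁ (hyp (here refl))
    ; (suc zero)       → ∧E₁ (∧E₂ (hyp (here refl)))
    ; (suc (suc zero)) → ∧E₁ (∧E₂ (∧E₂ (hyp (here refl)))) })))))))

module _ {n : ℕ} {Γ : Context n} where

  ∃-value-I : ∀ {w} φ → Γ ⊢ φ [ ⟨ w ⟩ ] → Γ ⊢ ∃̇ ((⊥̇ ⇒ ⊥̇) ∧ var zero ≐ ⟨ w ⟩ ∧ φ)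
  ∃-value-I φ d = ∃I _ (∧I in-domain (∧I (≐-refl _) d))

  -- A constant is translated by quantifying over its value. The graph clause determines that value,
  -- so `∃-unique` applies once the trivial domain clause is dropped.
  ∃-value-E : ∀ {w} φ → Γ ⊢ ∃̇ ((⊥̇ ⇒ ⊥̇) ∧ var zero ≐ ⟨ w ⟩ ∧ φ) → Γ ⊢ φ [ ⟨ w ⟩ ]
  ∃-value-E φ d = ∃-unique (var zero ≐ ⟨ _ ⟩) φ
    (∃E d (∃I (var zero) (cast (sym (cong (_ ∧_) (rename-lift-[var] φ))) (∧E₂ (hyp (here refl))))))
    (hyp (here refl))

module _ {n : ℕ} {Γ : Context n} where

  segments-≼ : ∀ i t → Γ ⊢ translate (⋁ (map (λ s → var i ≐ str s) (initialSegments t))) ⇒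
    var i ⊑⁺ ⟨ encode t ⟩ ∧ ¬̇ (var i ≐ ⟨ [] ⟩)
  segments-≼ i t =
    ≡.subst (λ ψ → Γ ⊢ ψ ⇒ var i ⊑⁺ ⟨ encode t ⟩ ∧ ¬̇ (var i ≐ ⟨ [] ⟩))
      (sym (translate-⋁ (λ s → var i ≐ str s) (initialSegments t)))
      (⋁E (λ s → translate (var i ≐ str s)) (initialSegments t) λ {s} p →
        ⇒I (segment s (∈-initialSegments⁻ t p) (∃-value-E (var (suc i) ≐ var zero) (hyp (here refl)))))
    where
    segment : ∀ {Δ} s → ∃[ r ] encode s ++ r ≡ encode t → Δ ⊢ var i ≐ ⟨ encode s ⟩ →
      Δ ⊢ var i ⊑⁺ ⟨ encode t ⟩ ∧ ¬̇ (var i ≐ ⟨ [] ⟩)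
    segment (b ∷ bs) (r , eq) d = ∧I
      (⊑-cong (≐-sym d) (⟨⟩-cong eq) (⊑-intro (encode (b ∷ bs)) r))
      (⇒I (⟨⟩-injective (encode (b ∷ bs)) []
        (≐-trans (≐-sym (under-⊢ d)) (hyp (here refl))) λ ()))

  -- An element below the encoding is one of its initial segments; the empty one is refuted by the
  -- second conjunct, and any other encodes an initial segment of `t`.
  ≼-segments : ∀ i t → Γ ⊢ var i ⊑⁺ ⟨ encode t ⟩ ∧ ¬̇ (var i ≐ ⟨ [] ⟩) ⇒
    translate (⋁ (map (λ s → var i ≐ str s) (initialSegments t)))
  ≼-segments i t =
    ≡.subst (λ ψ → Γ ⊢ var i ⊑⁺ ⟨ encode t ⟩ ∧ ¬̇ (var i ≐ ⟨ [] ⟩) ⇒ ψ)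
      (sym (translate-⋁ g (initialSegments t)))
      (⇒I (⇒E (⊑-elim (encode t) λ u r eq → ⇒I (segment u r eq)) (∧E₁ (hyp (here refl)))))
    where
    g : BinaryString → Formula WDSig n
    g s = var i ≐ str s

    segment : ∀ {Δ} u r → u ++ r ≡ encode t →
      var i ≐ ⟨ u ⟩ ∷ var i ⊑⁺ ⟨ encode t ⟩ ∧ ¬̇ (var i ≐ ⟨ [] ⟩) ∷ Δ ⊢
        ⋁ (map (translate ∘ g) (initialSegments t))
    segment []      r eq = ⊥E (⇒E (∧E₂ (hyp (there (here refl)))) (hyp (here refl)))
    segment (d ∷ u) r eq with ∈-initialSegments⁺ t eq (λ ())
    ... | s , p , q = ⋁I (translate ∘ g) p (∃-value-I (var (suc i) ≐ var zero)
      (≐-trans (hyp (here refl)) (⟨⟩-cong (sym q))))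

WD-R-axioms : ∀ {φ} → WD-R φ → [] ⊢ translate φ
WD-R-axioms (identity a) = identity-axioms a
WD-R-axioms (wd1 s t) = ∃-value-I _ (∃-value-I _ (∃-value-I _
  (≡.subst (λ w → _⊢_ {0} [] (TotalConcat ⟨ encode s ⟩ ⟨ encode t ⟩ ⟨ w ⟩)) (sym (encode-⁺++⁺ s t))
    (total-concat-⟨⟩ (encode s) (encode t)))))
WD-R-axioms (wd2 s t s≢t) = ⇒I (⟨⟩-injective (encode s) (encode t)
  (∃-value-E (⟨ encode s ⟩ ≐ var zero) (∃-value-E (∃̇ ((⊥̇ ⇒ ⊥̇) ∧ var zero ≐ ⟨ encode t ⟩ ∧
    var (suc zero) ≐ var zero)) (hyp (here refl))))
  λ eq → contradiction (encode-injective eq) s≢t)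
WD-R-axioms (wd3 t) = ∀ᵈI (∧I
  (⇒I (⇒E (≼-segments zero t)
    (∃-value-E (var (suc zero) ⊑⁺ var zero ∧ ¬̇ (var (suc zero) ≐ ⟨ [] ⟩)) (hyp (here refl)))))
  (⇒I (∃-value-I (var (suc zero) ⊑⁺ var zero ∧ ¬̇ (var (suc zero) ≐ ⟨ [] ⟩))
    (⇒E (segments-≼ zero t) (hyp (here refl))))))
WD-R-axioms wd4 = ∀ᵈI (∀ᵈI (∃E (total-concat-exists (suc zero) zero)
  (∃I (var zero) (∧I in-domain (hyp (here refl))))))
WD-R-axioms wd5 = ∀ᵈI (∀ᵈI (∀ᵈI (∀ᵈI (total-concat-unique _ _ _ _))))

-- The interpretation

graph-total⁺ : ∀ s → _⊢_ {0} [] (∃̇ ((⊥̇ ⇒ ⊥̇) ∧ var zero ≐ ⟨ encode s ⟩))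
graph-total⁺ s = ∃I ⟨ encode s ⟩ (∧I in-domain (≐-refl _))

graph-unique⁺ : ∀ s → [] ⊢ (⊥̇ ⇒ ⊥̇) ⇒ (⊥̇ ⇒ ⊥̇) ⇒
  rename (liftᵣ suc) (var (zero {0}) ≐ ⟨ encode s ⟩) ⇒ rename suc (var zero ≐ ⟨ encode s ⟩) ⇒
  var zero ≐ var (suc zero)
graph-unique⁺ s = ⇒I (⇒I (⇒I (⇒I (≐-trans (hyp (there (here refl))) (≐-sym (hyp (here refl)))))))

mainTheorem6 : VW⁺ Interprets WD-R
mainTheorem6 = record
  { translation     = ⌜ translation⁺ ⌝ᵀ
  ; domain-nonempty = ⌜⊢⌝ {φ = ∃̇ (⊥̇ ⇒ ⊥̇)} (∃I ⟨ [] ⟩ in-domain)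
  ; graph-total     = λ { (const s) → ⌜⊢⌝ (graph-total⁺ s) }
  ; graph-unique    = λ { (const s) → cast
      (cong₂ (λ φ ψ → (⊥̇ ⇒ ⊥̇) ⇒ (⊥̇ ⇒ ⊥̇) ⇒ φ ⇒ ψ ⇒ var zero ≐ var (suc zero))
        (⌜rename⌝ (liftᵣ suc) (var zero ≐ ⟨ encode s ⟩)) (⌜rename⌝ suc (var zero ≐ ⟨ encode s ⟩)))
      (⌜⊢⌝ (graph-unique⁺ s)) }
  -- Expanding the translated formula is the same as translating with the expanded translation.
  ; axioms          = λ {φ} a → cast (⌜translate⌝ translation⁺ φ) (⌜⊢⌝ (WD-R-axioms a))
  }
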